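{- In the setting of the context, let $f:\mathcal{D}_{I_1}\times\cdots\times\mathcal{D}_{I_r}\to D/J$ be a polynomial function. Let $S=\{\mathbf{k}=(k_1,\ldots,k_r)\in\mathbb{N}^r:\ k_i<\mu(I_i,J)\text{ for all }1\le i\le r\}$. Then there exist coefficients $b_{\mathbf{k}}\in R$ ($\mathbf{k}\in S$), only finitely many nonzero, such that $F=\sum_{\mathbf{k}\in S}b_{\mathbf{k}}(\mathbf{x})_{\mathbf{k}}\in R[x_1,\ldots,x_r]$ represents $f$. Moreover, the coefficients are uniquely determined modulo the ideals $\operatorname{Ann}_J\big(v_{k_1}(X_1)\cdots v_{k_r}(X_r)\big)$: if $(b'_{\mathbf{k}})_{\mathbf{k}\in S}$ is another finitely supported family in $R$, then $\sum_{\mathbf{k}\in S}b'_{\mathbf{k}}(\mathbf{x})_{\mathbf{k}}$ also represents $f$ if and only if $b_{\mathbf{k}}-b'_{\mathbf{k}}\in\operatorname{Ann}_J\big(v_{k_1}(X_1)\cdots v_{k_r}(X_r)\big)$ for every $\mathbf{k}=(k_1,\ldots,k_r)\in S$.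
   Context: Standing setting. $D$ is a Dedekind domain, $r\ge1$, and $I_1,\ldots,I_r,J$ are ideals of $D$ different from $0$ and $D$. For each $i$ a complete set of residues $\mathcal{D}_{I_i}\subseteq D$ modulo $I_i$ with $0\in\mathcal{D}_{I_i}$ is fixed, identified with $D/I_i$. Let $K=\operatorname{lcm}[I_1,\ldots,I_r,J]=I_1\cap\cdots\cap I_r\cap J$ and $R=D/K$; for an ideal $I\supseteq K$ of $D$ write $\bar I=I/K\subseteq R$, so $R/\bar J\cong D/J$. Let $X_i\subseteq R$ be the image of $\mathcal{D}_{I_i}$ under $D\to R$ (the map is injective on $\mathcal{D}_{I_i}$, so $|X_i|=|D/I_i|$). Write $K=P_1^{e_1}\cdots P_n^{e_n}$ with distinct primes $P_l$ and $e_l\ge1$; the nonzero prime ideals of $R$ are $\bar P_1,\ldots,\bar P_n$. $P$-orderings. For a nonzero prime $\bar P$ of $R$ and $a\in R$, $w_{\bar P}(a)$ denotes the highest power of $\bar P$ containing $a$ (with $w_{\bar P}(0)$ the zero ideal); powers of $\bar P$ are totally ordered by inclusion. For a nonempty subset $X\subseteq R$, a $\bar P$-ordering of $X$ is a sequence $b_0,b_1,\ldots$ in $X$ with $b_0$ arbitrary and, for $k\ge1$, $b_k\in X$ chosen so that $w_{\bar P}\big((b_k-b_0)\cdots(b_k-b_{k-1})\big)$ is as large as possible (minimal exponent of $\bar P$). Its $\bar P$-sequence is $v_0(X,\bar P)=R$, $v_k(X,\bar P)=w_{\bar P}\big((b_k-b_0)\cdots(b_k-b_{k-1})\big)$ for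 $k\ge1$; it does not depend on the chosen $\bar P$-ordering, and for every $a\in X$ one has $w_{\bar P}((a-b_0)\cdots(a-b_{k-1}))\subseteq v_k(X,\bar P)$. The factorial ideals are $v_k(X)=\prod_{l=1}^n v_k(X,\bar P_l)$ (so $v_0(X)=R$, and $v_k(X)=0$ for $k\ge|X|$ if $X$ is finite). Fixed sequences. For each $i$ and $l$ fix a $\bar P_l$-ordering $(a_{l,i,j})_{j\in\mathbb{N}}$ of $X_i$ with $a_{l,i,0}=0$, and let $a_{i,j}\in R$ be the element with $a_{i,0}=0$ and $a_{i,j}\equiv a_{l,i,j}\pmod{\bar P_l^{e_l}}$ for all $l$ (Chinese Remainder Theorem). Then $v_k(X_i)=\langle (a_{i,k}-a_{i,0})\cdots(a_{i,k}-a_{i,k-1})\rangle$. For $\mathbf{k}=(k_1,\ldots,k_r)\in\mathbb{N}^r$ put $(\mathbf{x})_{\mathbf{k}}=\prod_{i=1}^r (x_i)_{k_i}$ where $(x_i)_0=1$ and $(x_i)_{k}=\prod_{j=0}^{k-1}(x_i-a_{i,j})$ for $k\ge1$. Further notation. $\mu(I_i,J)$ is the smallest positive integer $k$ with $v_k(X_i)\subseteq\bar J$ if such $k$ exists, and $|D/I_i|$ otherwise (possibly infinite). For an ideal $I$ of $R$, $\operatorname{Ann}_J(I)=\{b\in R: bI\subseteq\bar J\}$. Polynomial functions. A function $f:\mathcal{D}_{I_1}\times\cdots\times\mathcal{D}_{I_r}\to D/J$ is a polynomial function if some $F\in D[x_1,\ldots,x_r]$ satisfies $F(b)\equiv f(b)\pmod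 J$ for all $b\in\mathcal{D}_{I_1}\times\cdots\times\mathcal{D}_{I_r}$. A polynomial $F\in R[x_1,\ldots,x_r]$ represents $f$ if for every $b=(b_1,\ldots,b_r)\in\mathcal{D}_{I_1}\times\cdots\times\mathcal{D}_{I_r}$, the value of $F$ at the images of $b_1,\ldots,b_r$ in $R$ maps to $f(b)$ under $R\to R/\bar J=D/J$. -}

module Defs where

open import Level using (Level; _⊔_) renaming (suc to lsuc)
open import Algebra.Bundles using (CommutativeRing; Semiring)
import Algebra.Definitions.RawSemiring as RawSemiringDefs
import Algebra.Properties.AbelianGroup as AbelianGroupProperties
import Algebra.Properties.CommutativeSemigroup as CommutativeSemigroupProperties
import Algebra.Properties.Ring as RingProperties
open import Data.Fin.Base using (Fin; toℕ)
open import Data.List.Base as List using (List; []; _∷_; _++_)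
open import Data.Nat.Base as ℕ using (ℕ; zero; suc; _∸_)
open import Data.Product.Base using (∃-syntax; Σ-syntax; _×_; _,_; proj₁; proj₂)
open import Data.Sum.Base using (_⊎_)
open import Data.Vec.Base as Vec using (Vec; []; _∷_; lookup)
open import Data.Vec.Functional using (Vector; foldr)
open import Data.Vec.Functional.Relation.Binary.Equality.Setoid using (≋-setoid)
open import Function.Bundles using (Func; Inverse)
open import Relation.Binary.Bundles using (Setoid)
import Relation.Binary.Construct.Add.Supremum.Strict as AddSupremum
import Relation.Binary.Construct.On as On
open import Relation.Binary.Definitions using (_Respects_)
open import Relation.Binary.PropositionalEquality.Core using (_≡_; _≢_)
open import Relation.Binary.PropositionalEquality.Properties as ≡ using ()
import Relation.Binary.Reasoning.Setoid as SetoidReasoning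
open import Relation.Nullary.Construct.Add.Supremum using (_⁺; [_]; ⊤⁺)
open import Relation.Nullary.Negation.Core using (¬_)
open import Relation.Unary using (Pred; _∈_; _⊆_; _≐_; _∩_; ⋂)
open import Relation.Unary.Polymorphic using (U)

private
  variable
    c ℓ : Level

------------------------------------------------------------------------
-- Ideals of a commutative ring, as predicates on its carrier

module Ideals (R : CommutativeRing c ℓ) where
  open CommutativeRing R
  open RawSemiringDefs (Semiring.rawSemiring semiring) using (sum; _^_; _∣_)

  Subset : Set (lsuc (c ⊔ ℓ))
  Subset = Pred Carrier (c ⊔ ℓ)

  record IsIdeal (I : Subset) : Set (c ⊔ ℓ) where
    field
      resp     : I Respects _≈_
      0∈       : 0# ∈ I
      +-closed : ∀ {x y} → x ∈ I → y ∈ I → x + y ∈ I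
      *-closed : ∀ x {y} → y ∈ I → x * y ∈ I

  IsZero IsWhole : Subset → Set (c ⊔ ℓ)
  IsZero  I = ∀ x → x ∈ I → x ≈ 0#
  IsWhole I = ∀ x → x ∈ I

  record IsPrime (P : Subset) : Set (c ⊔ ℓ) where
    field
      isIdeal : IsIdeal P
      proper  : ¬ IsWhole P
      split   : ∀ x y → x * y ∈ P → x ∈ P ⊎ y ∈ P

  record IsMaximal (M : Subset) : Set (lsuc (c ⊔ ℓ)) where
    field
      isIdeal : IsIdeal M
      proper  : ¬ IsWhole M
      maximal : ∀ A → IsIdeal A → M ⊆ A → A ≐ M ⊎ IsWhole A

  infixl 7 _·_
  infixr 8 _^ᴵ_

  _·_ : Subset → Subset → Subset
  (I · J) x = ∃[ n ] Σ[ a ∈ Vector Carrier n ] Σ[ b ∈ Vector Carrier n ]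
    (∀ i → a i ∈ I) × (∀ i → b i ∈ J) × x ≈ sum (λ i → a i * b i)

  _^ᴵ_ : Subset → ℕ → Subset
  I ^ᴵ zero  = U
  I ^ᴵ suc m = I · I ^ᴵ m

  ∏ᴵ : ∀ {n} → Vector Subset n → Subset
  ∏ᴵ = foldr _·_ U

  IsIntegralDomain : Set (c ⊔ ℓ)
  IsIntegralDomain = ¬ 1# ≈ 0# × (∀ x y → x * y ≈ 0# → x ≈ 0# ⊎ y ≈ 0#)

  IsNoetherian : Set (lsuc (c ⊔ ℓ))
  IsNoetherian = (A : ℕ → Subset) → (∀ k → IsIdeal (A k)) →
    (∀ k → A k ⊆ A (suc k)) → ∃[ n ] (∀ m → n ℕ.≤ m → A m ⊆ A n)

  -- Integrally closed in the field of fractions: a fraction a / b which is a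
  -- root of the monic polynomial T ^ n + Σ_{i < n} cᵢ T ^ i lies in R.  The
  -- equation in the field of fractions is multiplied by b ^ n.
  IsIntegrallyClosed : Set (c ⊔ ℓ)
  IsIntegrallyClosed = ∀ a b → ¬ b ≈ 0# → ∀ n (cs : Vector Carrier n) →
    a ^ n + sum (λ i → cs i * (a ^ toℕ i * b ^ (n ∸ toℕ i))) ≈ 0# → b ∣ a

  record IsDedekindDomain : Set (lsuc (c ⊔ ℓ)) where
    field
      isIntegralDomain   : IsIntegralDomain
      isNoetherian       : IsNoetherian
      isIntegrallyClosed : IsIntegrallyClosed
      dimension≤1        : ∀ P → IsPrime P → ¬ IsZero P → IsMaximal P

  IsHighestPower : Subset → Carrier → ℕ → Set (c ⊔ ℓ)
  IsHighestPower P a m = a ∈ P ^ᴵ m × (∀ m′ → a ∈ P ^ᴵ m′ → P ^ᴵ m ⊆ P ^ᴵ m′)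

  -- The highest power of P containing a, or 0 if a is zero
  w : Subset → Carrier → Subset
  w P a x = (a ≈ 0# × x ≈ 0#)
          ⊎ (¬ a ≈ 0# × ∃[ m ] (IsHighestPower P a m × x ∈ P ^ᴵ m))

  -- (x - b 0) ⋯ (x - b (k - 1))
  differences : (ℕ → Carrier) → ℕ → Carrier → Carrier
  differences b zero    x = 1#
  differences b (suc k) x = differences b k x * (x - b k)

  record IsOrdering (P X : Subset) (b : ℕ → Carrier) : Set (c ⊔ ℓ) where
    field
      b∈X     : ∀ k → b k ∈ X
      minimal : ∀ k → 1 ℕ.≤ k → ∀ x → x ∈ X →
                w P (differences b k x) ⊆ w P (differences b k (b k))

  -- The P-sequence v₀, v₁, … computed from a P-ordering b
  orderingSequence : Subset → (ℕ → Carrier) → ℕ → Subset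
  orderingSequence P b zero    = U
  orderingSequence P b (suc k) = w P (differences b (suc k) (b (suc k)))

------------------------------------------------------------------------
-- The quotient ring R / I: the carrier and the operations of R, with
-- congruence modulo I as equality.  Hence R → R / I is the identity on
-- carriers, and A ⊇ I and its image A / I are the same predicate.

module _ (R : CommutativeRing c ℓ) where
  open CommutativeRing R
  open Ideals R
  open AbelianGroupProperties +-abelianGroup using (⁻¹-anti-homo‿-; ⁻¹-∙-comm)
  open CommutativeSemigroupProperties +-commutativeSemigroup using (interchange)
  open RingProperties ring using (-1*x≈-x; x[y-z]≈xy-xz; [y-z]x≈yx-zx)

  quotientRing : (I : Subset) → IsIdeal I → CommutativeRing c (c ⊔ ℓ)
  quotientRing I isIdeal = record
    { Carrier = Carrier
    ; _≈_     = λ x y → x - y ∈ I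
    ; _+_     = _+_
    ; _*_     = _*_
    ; -_      = -_
    ; 0#      = 0#
    ; 1#      = 1#
    ; isCommutativeRing = record
      { isRing = record
        { +-isAbelianGroup = record
          { isGroup = record
            { isMonoid = record
              { isSemigroup = record
                { isMagma = record
                  { isEquivalence = record
                    { refl  = lift refl
                    ; sym   = λ {x} {y} p → resp (⁻¹-anti-homo‿- x y) (-‿closed p)
                    ; trans = λ {x} {y} {z} p q → resp (telescope x y z) (+-closed p q)
                    }
                  ; ∙-cong = λ {x} {y} {u} {v} p q → resp (+-difference x y u v) (+-closed p q)
                  }
                ; assoc = λ x y z → lift (+-assoc x y z)
                }
              ; identity = (λ x → lift (+-identityˡ x)) , (λ x → lift (+-identityʳ x))
              }
            ; inverse = (λ x → lift (-‿inverseˡ x)) , (λ x → lift (-‿inverseʳ x))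
            ; ⁻¹-cong = λ {x} {y} p → resp (sym (⁻¹-∙-comm x (- y))) (-‿closed p)
            }
          ; comm = λ x y → lift (+-comm x y)
          }
        ; *-cong = λ {x} {y} {u} {v} p q →
            resp (*-difference x y u v) (+-closed (*-closed u p) (*-closed y q))
        ; *-assoc    = λ x y z → lift (*-assoc x y z)
        ; *-identity = (λ x → lift (*-identityˡ x)) , (λ x → lift (*-identityʳ x))
        ; distrib    = (λ x y z → lift (distribˡ x y z)) , (λ x y z → lift (distribʳ x y z))
        }
      ; *-comm = λ x y → lift (*-comm x y)
      }
    }
    where
    open IsIdeal isIdeal
    open SetoidReasoning setoid

    lift : ∀ {x y} → x ≈ y → x - y ∈ I
    lift {x} {y} x≈y = resp (sym (trans (+-congʳ x≈y) (-‿inverseʳ y))) 0∈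

    -‿closed : ∀ {x} → x ∈ I → - x ∈ I
    -‿closed {x} p = resp (-1*x≈-x x) (*-closed (- 1#) p)

    telescope : ∀ x y z → (x - y) + (y - z) ≈ x - z
    telescope x y z = begin
      (x - y) + (y - z)     ≈⟨ +-assoc x (- y) (y - z) ⟩
      x + (- y + (y - z))   ≈⟨ +-congˡ (+-assoc (- y) y (- z)) ⟨
      x + ((- y + y) - z)   ≈⟨ +-congˡ (+-congʳ (-‿inverseˡ y)) ⟩
      x + (0# - z)          ≈⟨ +-congˡ (+-identityˡ (- z)) ⟩
      x - z                 ∎

    +-difference : ∀ x y u v → (x - y) + (u - v) ≈ (x + u) - (y + v)
    +-difference x y u v = begin
      (x - y) + (u - v)       ≈⟨ interchange x (- y) u (- v) ⟩
      (x + u) + (- y + - v)   ≈⟨ +-congˡ (⁻¹-∙-comm y v) ⟩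
      (x + u) - (y + v)       ∎

    *-difference : ∀ x y u v → u * (x - y) + y * (u - v) ≈ x * u - y * v
    *-difference x y u v = begin
      u * (x - y) + y * (u - v)           ≈⟨ +-congʳ (*-comm u (x - y)) ⟩
      (x - y) * u + y * (u - v)           ≈⟨ +-cong ([y-z]x≈yx-zx u x y) (x[y-z]≈xy-xz y u v) ⟩
      (x * u - y * u) + (y * u - y * v)   ≈⟨ telescope (x * u) (y * u) (y * v) ⟩
      x * u - y * v                       ∎

------------------------------------------------------------------------
-- Polynomials in r variables, as finite formal sums of terms a x₁^m₁ ⋯ xᵣ^mᵣ

module Polynomials (R : CommutativeRing c ℓ) (r : ℕ) where
  open CommutativeRing R
  open RawSemiringDefs (Semiring.rawSemiring semiring) using (product; _^_)

  Polynomial : Set c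
  Polynomial = List (Carrier × Vec ℕ r)

  constant : Carrier → Polynomial
  constant a = (a , Vec.replicate r 0) ∷ []

  var : Fin r → Polynomial
  var i = (1# , Vec.replicate r 0 Vec.[ i ]≔ 1) ∷ []

  infixl 6 _+ᴾ_
  infixl 7 _*ᴾ_

  _+ᴾ_ _*ᴾ_ : Polynomial → Polynomial → Polynomial
  _+ᴾ_ = _++_
  _*ᴾ_ = List.cartesianProductWith
    (λ (a , m) (b , m′) → a * b , Vec.zipWith ℕ._+_ m m′)

  eval : Polynomial → Vector Carrier r → Carrier
  eval F x =
    List.foldr _+_ 0# (List.map (λ (a , m) → a * product (λ i → x i ^ lookup m i)) F)

-- {0, …, N - 1} ^ r
box : ∀ r → ℕ → List (Vec ℕ r)
box zero    N = [] ∷ []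
box (suc r) N = List.cartesianProductWith _∷_ (List.upTo N) (box r N)

------------------------------------------------------------------------
-- Extended naturals and cardinalities

ℕ∞ : Set
ℕ∞ = ℕ ⁺

open AddSupremum ℕ._<_ public using () renaming (_<⁺_ to _<∞_)

HasCardinality : Setoid c ℓ → ℕ∞ → Set (c ⊔ ℓ)
HasCardinality S [ n ] = Inverse (≡.setoid (Fin n)) S
HasCardinality S ⊤⁺    = ∀ n → ¬ Inverse (≡.setoid (Fin n)) S

------------------------------------------------------------------------

record IsResidueSystem (D : CommutativeRing c ℓ) (I 𝒟 : Ideals.Subset D) : Set (c ⊔ ℓ) where
  open CommutativeRing D
  field
    resp     : 𝒟 Respects _≈_
    complete : ∀ x → ∃[ d ] (d ∈ 𝒟 × x - d ∈ I)
    unique   : ∀ d d′ → d ∈ 𝒟 → d′ ∈ 𝒟 → d - d′ ∈ I → d ≈ d′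
    0∈       : 0# ∈ 𝒟

record Setting (c ℓ : Level) : Set (lsuc (c ⊔ ℓ)) where
  field
    D : CommutativeRing c ℓ
  open Ideals D public using (Subset)
  field
    isDedekind      : Ideals.IsDedekindDomain D
    r               : ℕ
    r≥1             : 1 ℕ.≤ r
    I               : Fin r → Subset
    J               : Subset
    I-isIdeal       : ∀ i → Ideals.IsIdeal D (I i)
    J-isIdeal       : Ideals.IsIdeal D J
    I≢0             : ∀ i → ¬ Ideals.IsZero D (I i)
    J≢0             : ¬ Ideals.IsZero D J
    I≢D             : ∀ i → ¬ Ideals.IsWhole D (I i)
    J≢D             : ¬ Ideals.IsWhole D J
    𝒟               : Fin r → Subset
    isResidueSystem : ∀ i → IsResidueSystem D (I i) (𝒟 i)

  K : Subset
  K = ⋂ (Fin r) I ∩ J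

  K-isIdeal : Ideals.IsIdeal D K
  K-isIdeal = record
    { resp     = λ x≈y p → (λ i → II.resp i x≈y (proj₁ p i)) , IJ.resp x≈y (proj₂ p)
    ; 0∈       = (λ i → II.0∈ i) , IJ.0∈
    ; +-closed = λ p q → (λ i → II.+-closed i (proj₁ p i) (proj₁ q i))
                       , IJ.+-closed (proj₂ p) (proj₂ q)
    ; *-closed = λ x p → (λ i → II.*-closed i x (proj₁ p i)) , IJ.*-closed x (proj₂ p)
    }
    where
    module II i = Ideals.IsIdeal (I-isIdeal i)
    module IJ = Ideals.IsIdeal J-isIdeal

  R : CommutativeRing c (c ⊔ ℓ)
  R = quotientRing D K K-isIdeal

  D/J : CommutativeRing c (c ⊔ ℓ)
  D/J = quotientRing D J J-isIdeal

  D/I : Fin r → CommutativeRing c (c ⊔ ℓ)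
  D/I i = quotientRing D (I i) (I-isIdeal i)

  -- The image of 𝒟 i in R
  X : Fin r → Ideals.Subset R
  X i x = ∃[ d ] (d ∈ 𝒟 i × CommutativeRing._≈_ R x d)

record FixedSequences {c ℓ : Level} (S : Setting c ℓ) : Set (lsuc (c ⊔ ℓ)) where
  open Setting S
  open CommutativeRing R using (Carrier; _≈_; _-_; 0#)
  field
    n          : ℕ
    P          : Fin n → Subset
    P-isPrime  : ∀ l → Ideals.IsPrime D (P l)
    P-distinct : ∀ l l′ → l ≢ l′ → ¬ P l ≐ P l′
    e          : Fin n → ℕ
    e≥1        : ∀ l → 1 ℕ.≤ e l
    K≐∏P^e     : K ≐ Ideals.∏ᴵ D (λ l → Ideals._^ᴵ_ D (P l) (e l))
  open Ideals R using (IsOrdering; _^ᴵ_)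
  field
    aₗ            : Fin n → Fin r → ℕ → Carrier
    aₗ-isOrdering : ∀ l i → IsOrdering (P l) (X i) (aₗ l i)
    aₗ-zero       : ∀ l i → aₗ l i 0 ≈ 0#
    a             : Fin r → ℕ → Carrier
    a-zero        : ∀ i → a i 0 ≈ 0#
    a-crt         : ∀ i j l → a i j - aₗ l i j ∈ P l ^ᴵ e l

module Notation {c ℓ : Level} (S : Setting c ℓ) (Q : FixedSequences S) where
  open Setting S
  open FixedSequences Q
  open CommutativeRing R using (Carrier; _≈_; _*_; _-_; -_; 0#; 1#)
  open Ideals R using (∏ᴵ; orderingSequence)
  open Polynomials R r

  -- By w P 0 = 0, the P-sequences of two P-orderings may differ in that one
  -- has the ideal 0 where the other has the least power of P; the product over
  -- l is not affected.
  v : Fin r → ℕ → Subset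
  v i k = ∏ᴵ (λ l → orderingSequence (P l) (aₗ l i) k)

  Isμ : Fin r → ℕ∞ → Set (c ⊔ ℓ)
  Isμ i μ =
      (∃[ k ] (μ ≡ [ k ] × 1 ℕ.≤ k × v i k ⊆ J × (∀ j → 1 ℕ.≤ j → v i j ⊆ J → k ℕ.≤ j)))
    ⊎ ((∀ k → 1 ℕ.≤ k → ¬ v i k ⊆ J) × HasCardinality (CommutativeRing.setoid (D/I i)) μ)

  𝐒 : Pred (Vec ℕ r) (c ⊔ ℓ)
  𝐒 k = ∀ i → ∃[ μ ] (Isμ i μ × [ lookup k i ] <∞ μ)

  Ann : Subset → Subset
  Ann A b = ∀ x → x ∈ A → b * x ∈ J

  falling₁ : Fin r → ℕ → Polynomial
  falling₁ i zero    = constant 1#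
  falling₁ i (suc k) = falling₁ i k *ᴾ (var i +ᴾ constant (- a i k))

  -- (𝐱)_𝐤
  falling : Vec ℕ r → Polynomial
  falling k = foldr _*ᴾ_ (constant 1#) (λ i → falling₁ i (lookup k i))

  -- A finitely supported family (b_𝐤) indexed by 𝐒, extended by zero to ℕ^r
  record Family : Set (c ⊔ ℓ) where
    field
      coeff       : Vec ℕ r → Carrier
      bound       : ℕ
      zeroOutside : ∀ k → ¬ k ∈ 𝐒 → coeff k ≈ 0#
      finite      : ∀ k → ¬ (∀ i → lookup k i ℕ.< bound) → coeff k ≈ 0#

  -- Σ_𝐤 b_𝐤 (𝐱)_𝐤
  polynomial : Family → Polynomial
  polynomial b =
    List.concatMap (λ k → constant (coeff k) *ᴾ falling k) (box r bound)
    where open Family b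

  Domain : Setoid (c ⊔ ℓ) ℓ
  Domain = On.setoid {B = Σ[ b ∈ Vector Carrier r ] (∀ i → b i ∈ 𝒟 i)}
    (≋-setoid (CommutativeRing.setoid D) r) proj₁

  Function : Set (c ⊔ ℓ)
  Function = Func Domain (CommutativeRing.setoid D/J)

  IsPolynomialFunction : Function → Set (c ⊔ ℓ)
  IsPolynomialFunction f = Σ[ F ∈ Polynomials.Polynomial D r ] (∀ b →
    CommutativeRing._≈_ D/J (Polynomials.eval D r F (proj₁ b)) (Func.to f b))

  Represents : Polynomial → Function → Set (c ⊔ ℓ)
  Represents F f =
    ∀ b → CommutativeRing._≈_ D/J (eval F (proj₁ b)) (Func.to f b)

  vAt : Vec ℕ r → Subset
  vAt k = ∏ᴵ (λ i → v i (lookup k i))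

{-# OPTIONS --safe #-}

-- The ring R = D / K is semilocal.  Let P be one of its maximal primes.  In D, P
-- is an annihilator (a : b), and integral closedness prevents b / a from mapping
-- P into itself; this gives q ∈ P and u ∉ P with u P ⊆ q D, so the localisation
-- of R at P is a chain ring, in which d divides every element of w(d).
-- Hence, for a P-ordering (b_j) of X, the value (b_k - b_0) ⋯ (b_k - b_(k-1))
-- divides all values on X of (x - b_0) ⋯ (x - b_(k-1)).  Gluing over the primes,
-- v_k(X_i) is generated by δ_(i,k) = (a_(i,k) - a_(i,0)) ⋯ (a_(i,k) - a_(i,k-1)),
-- and δ_(i,k) divides (x_i)_k on X_i.
--
-- If Σ c_𝐤 (𝐱)_𝐤 vanishes modulo J on ∏ X_i, then localising at P, where a_(i,j)
-- may be replaced by the P-ordering of X_i, and evaluating successively at its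
-- terms gives c_𝐤 ∏ δ_(i,k_i) ∈ J; the converse is the divisibility above.  For
-- existence, every polynomial is a combination of the (𝐱)_𝐤, and those with
-- 𝐤 ∉ 𝐒 vanish modulo J on ∏ X_i.
module Submission where

open import Defs
open import Level using (Level; _⊔_; Lift; lift; lower) renaming (suc to lsuc)
open import Algebra.Bundles using (CommutativeRing; Semiring)
import Algebra.Definitions.RawMagma as RawMagmaDefs
import Algebra.Definitions.RawSemiring as RawSemiringDefs
import Algebra.Properties.CommutativeMonoid.Sum as CommutativeMonoidSum
import Algebra.Solver.Ring
open import Algebra.Solver.Ring.AlmostCommutativeRing using (fromCommutativeRing; _-Raw-AlmostCommutative⟶_)
open import Axiom.ExcludedMiddle using (ExcludedMiddle)
open import Data.Empty using (⊥; ⊥-elim)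
open import Data.Fin.Base using (Fin; zero; suc; toℕ)
import Data.Fin.Properties as Fin
open import Data.Integer.Base as ℤ using (ℤ; +_; -[1+_]; _⊖_)
import Data.Integer.Properties as ℤ
open import Data.List.Base as List using (List; []; _∷_; _++_)
import Data.List.Properties as List
open import Data.Maybe.Base using (Maybe; just; nothing)
open import Data.Nat.Base as ℕ using (ℕ; zero; suc)
open import Data.Nat.GeneralisedArithmetic using (fold)
open import Data.Nat.Induction using (<-rec)
import Data.Nat.Properties as ℕ
open import Data.Product.Base using (∃-syntax; Σ-syntax; _×_; _,_; proj₁; proj₂)
open import Data.Sum.Base using (_⊎_; inj₁; inj₂; [_,_]′)
open import Data.Unit.Polymorphic.Base using (tt)
open import Data.Vec.Base as Vec using (Vec; []; _∷_; lookup)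
open import Data.Vec.Functional as Vector using (Vector)
import Data.Vec.Properties as Vec
open import Function.Base using (_∘_; id)
open import Function.Bundles using (Func; Inverse; _⇔_; mk⇔)
import Relation.Binary.Construct.Add.Supremum.Strict as AddSupremum
open AddSupremum ℕ._<_ using ([_]; [_]<⊤⁺)
open import Relation.Binary.PropositionalEquality as ≡ using (_≡_; _≢_)
import Relation.Binary.Reasoning.Setoid as SetoidReasoning
open import Relation.Nullary using (¬_; Dec; yes; no)
open import Relation.Nullary.Construct.Add.Supremum using ([_]; ⊤⁺)
open import Relation.Nullary.Decidable using (decidable-stable; map′)
open import Relation.Nullary.Negation using (contradiction)
open import Relation.Unary using (_∈_; _∉_; _⊆_; _≐_)
open import Relation.Unary.Polymorphic using (U)

-- No localisation is constructed. A statement at P is expressed by `Loc`: x belongs to A at P if s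
-- x ∈ A for some s ∉ P. Local statements become global because an ideal of R contained in no `P l`
-- contains 1. Two obstacles shape the gluing. The `a i j` come from the Chinese Remainder Theorem
-- and need not lie in `X i`, so information about values on `X i` cannot be evaluated at them; such
-- arguments are moved to a prime, where `a i j` is congruent to the term `aₗ l i j` of `X i`. And
-- `w P` sends 0 to the zero ideal of R, not only of the localisation at P: one zero term at one
-- prime makes the whole product of the sequences zero, and then the generator has to vanish at the
-- remaining primes as well. It does, because a zero term yields a monic polynomial of degree k that
-- vanishes on X. An ideal of D above K is the same predicate as its image in R, but a power of P
-- formed in R is the sum of the power formed in D and K.

-- Polynomial identities with integer coefficients

module IntegerSolver {c ℓ} (R : CommutativeRing c ℓ) where
  open CommutativeRing R
  open import Algebra.Properties.Semiring.Mult.TCOptimised semiring using (1+×; ×-homo-+; ×1-homo-*)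
    renaming (_×_ to _⋆_)
  open import Algebra.Properties.Ring ring
    using (-0#≈0#; -‿involutive; -‿distribˡ-*)
  open import Algebra.Properties.AbelianGroup +-abelianGroup using (⁻¹-∙-comm)
  open import Algebra.Properties.CommutativeSemigroup +-commutativeSemigroup using (interchange)
  open import Relation.Binary.Reasoning.Setoid setoid

  private
    -- The solver has to decide equality of coefficients, hence ℤ and not the ring itself. With the
    -- optimised multiple `_⋆_`, `⟦ + 0 ⟧` and `⟦ + 1 ⟧` compute to `0#` and `1#`.
    ⟦_⟧ : ℤ → Carrier
    ⟦ + n ⟧      = n ⋆ 1#
    ⟦ -[1+ n ] ⟧ = - (suc n ⋆ 1#)

    ⟦⟧-cong : ∀ {i j} → i ≡ j → ⟦ i ⟧ ≈ ⟦ j ⟧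
    ⟦⟧-cong ≡.refl = refl

    ⟦⟧-⊖ : ∀ m n → ⟦ m ⊖ n ⟧ ≈ m ⋆ 1# - n ⋆ 1#
    ⟦⟧-⊖ m       zero    = sym (trans (+-congˡ -0#≈0#) (+-identityʳ _))
    ⟦⟧-⊖ zero    (suc n) = sym (+-identityˡ _)
    ⟦⟧-⊖ (suc m) (suc n) = begin
      ⟦ suc m ⊖ suc n ⟧                     ≈⟨ ⟦⟧-cong (ℤ.[1+m]⊖[1+n]≡m⊖n m n) ⟩
      ⟦ m ⊖ n ⟧                             ≈⟨ ⟦⟧-⊖ m n ⟩
      m ⋆ 1# - n ⋆ 1#                       ≈⟨ +-identityˡ _ ⟨
      0# + (m ⋆ 1# - n ⋆ 1#)                ≈⟨ +-congʳ (-‿inverseʳ 1#) ⟨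
      (1# - 1#) + (m ⋆ 1# - n ⋆ 1#)         ≈⟨ interchange 1# (- 1#) (m ⋆ 1#) _ ⟩
      (1# + m ⋆ 1#) + (- 1# + - (n ⋆ 1#))   ≈⟨ +-congˡ (⁻¹-∙-comm 1# (n ⋆ 1#)) ⟩
      (1# + m ⋆ 1#) - (1# + n ⋆ 1#)         ≈⟨ +-cong (1+× m 1#) (-‿cong (1+× n 1#)) ⟨
      suc m ⋆ 1# - suc n ⋆ 1#               ∎

    +-homo : ∀ i j → ⟦ i ℤ.+ j ⟧ ≈ ⟦ i ⟧ + ⟦ j ⟧
    +-homo (+ m)    (+ n)    = ×-homo-+ 1# m n
    +-homo (+ m)    -[1+ n ] = ⟦⟧-⊖ m (suc n)
    +-homo -[1+ m ] (+ n)    = trans (⟦⟧-⊖ n (suc m)) (+-comm _ _)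
    +-homo -[1+ m ] -[1+ n ] = begin
      ⟦ -[1+ m ] ℤ.+ -[1+ n ] ⟧           ≈⟨ ⟦⟧-cong (≡.sym (ℤ.neg-distrib-+ (+ suc m) (+ suc n))) ⟩
      - ((suc m ℕ.+ suc n) ⋆ 1#)         ≈⟨ -‿cong (×-homo-+ 1# (suc m) (suc n)) ⟩
      - (suc m ⋆ 1# + suc n ⋆ 1#)        ≈⟨ ⁻¹-∙-comm _ _ ⟨
      - (suc m ⋆ 1#) + - (suc n ⋆ 1#)    ∎

    -‿homo : ∀ i → ⟦ ℤ.- i ⟧ ≈ - ⟦ i ⟧
    -‿homo (+ zero)  = sym -0#≈0#
    -‿homo (+ suc n) = refl
    -‿homo -[1+ n ]  = sym (-‿involutive _)

    *-homo⁺ : ∀ m j → ⟦ + m ℤ.* j ⟧ ≈ m ⋆ 1# * ⟦ j ⟧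
    *-homo⁺ m (+ n)    = trans (⟦⟧-cong (≡.sym (ℤ.pos-* m n))) (×1-homo-* m n)
    *-homo⁺ m -[1+ n ] = begin
      ⟦ + m ℤ.* -[1+ n ] ⟧        ≈⟨ ⟦⟧-cong (≡.sym (ℤ.neg-distribʳ-* (+ m) (+ suc n))) ⟩
      ⟦ ℤ.- (+ m ℤ.* + suc n) ⟧   ≈⟨ -‿homo (+ m ℤ.* + suc n) ⟩
      - ⟦ + m ℤ.* + suc n ⟧       ≈⟨ -‿cong (*-homo⁺ m (+ suc n)) ⟩
      - (m ⋆ 1# * (suc n ⋆ 1#))   ≈⟨ -‿distribʳ-* _ _ ⟩
      m ⋆ 1# * - (suc n ⋆ 1#)     ∎
      where open import Algebra.Properties.Ring ring using (-‿distribʳ-*)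

    *-homo : ∀ i j → ⟦ i ℤ.* j ⟧ ≈ ⟦ i ⟧ * ⟦ j ⟧
    *-homo (+ m)    j = *-homo⁺ m j
    *-homo -[1+ m ] j = begin
      ⟦ -[1+ m ] ℤ.* j ⟧        ≈⟨ ⟦⟧-cong (≡.sym (ℤ.neg-distribˡ-* (+ suc m) j)) ⟩
      ⟦ ℤ.- (+ suc m ℤ.* j) ⟧   ≈⟨ -‿homo (+ suc m ℤ.* j) ⟩
      - ⟦ + suc m ℤ.* j ⟧       ≈⟨ -‿cong (*-homo⁺ (suc m) j) ⟩
      - (suc m ⋆ 1# * ⟦ j ⟧)    ≈⟨ -‿distribˡ-* _ _ ⟩
      - (suc m ⋆ 1#) * ⟦ j ⟧    ∎

    morphism : ℤ.+-*-rawRing -Raw-AlmostCommutative⟶ fromCommutativeRing R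
    morphism = record
      { ⟦_⟧    = ⟦_⟧
      ; +-homo = +-homo
      ; *-homo = *-homo
      ; -‿homo = -‿homo
      ; 0-homo = refl
      ; 1-homo = refl
      }

    _coeff≟_ : ∀ i j → Maybe (⟦ i ⟧ ≈ ⟦ j ⟧)
    i coeff≟ j with i ℤ.≟ j
    ... | yes i≡j = just (⟦⟧-cong i≡j)
    ... | no _    = nothing

  open Algebra.Solver.Ring ℤ.+-*-rawRing (fromCommutativeRing R) morphism _coeff≟_ public
    using (solve; con; _:+_; _:*_; _:-_; :-_; _:=_)

-- Products, powers and local membership of ideals

module IdealProperties {c ℓ} (R : CommutativeRing c ℓ) where
  open CommutativeRing R hiding (zero)
  open Ideals R
  open RawSemiringDefs (Semiring.rawSemiring semiring) using (sum; product; _^_)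
  open IntegerSolver R

  module _ {A : Subset} (isIdeal : IsIdeal A) where
    open IsIdeal isIdeal

    *-closedʳ : ∀ {x} y → x ∈ A → x * y ∈ A
    *-closedʳ {x} y x∈A = resp (*-comm y x) (*-closed y x∈A)

    sum-closed : ∀ {n} {g : Vector Carrier n} → (∀ i → g i ∈ A) → sum g ∈ A
    sum-closed {zero}  g∈A = 0∈
    sum-closed {suc n} g∈A = +-closed (g∈A zero) (sum-closed (g∈A ∘ suc))

    product-closed : ∀ {n} {g : Vector Carrier n} i → g i ∈ A → product g ∈ A
    product-closed zero    gᵢ∈A = *-closedʳ _ gᵢ∈A
    product-closed (suc i) gᵢ∈A = *-closed _ (product-closed i gᵢ∈A)

    ∈-resp-≡ : ∀ {x y} → x - y ∈ A → y ∈ A → x ∈ A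
    ∈-resp-≡ {x} {y} x-y∈A y∈A =
      resp (solve 2 (λ x y → (x :- y) :+ y := x) refl x y) (+-closed x-y∈A y∈A)

    ∈⇒≡ : ∀ {x y} → x ∈ A → y ∈ A → x - y ∈ A
    ∈⇒≡ {x} {y} x∈A y∈A = +-closed x∈A
      (resp (solve 1 (λ y → (:- con (+ 1)) :* y := :- y) refl y) (*-closed (- 1#) y∈A))

    ∈⇒≡0 : ∀ {x} → x ∈ A → x - 0# ∈ A
    ∈⇒≡0 {x} = resp (solve 1 (λ x → x := x :- con (+ 0)) refl x)

    ≡0⇒∈ : ∀ {x} → x - 0# ∈ A → x ∈ A
    ≡0⇒∈ {x} = resp (solve 1 (λ x → x :- con (+ 0) := x) refl x)

    ≈⇒≡ : ∀ {x y} → x ≈ y → x - y ∈ A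
    ≈⇒≡ {x} {y} x≈y = resp (sym (trans (+-congʳ x≈y) (-‿inverseʳ y))) 0∈

    colon-isIdeal : ∀ y → IsIdeal (λ s → s * y ∈ A)
    colon-isIdeal y = record
      { resp     = λ s≈t → resp (*-congʳ s≈t)
      ; 0∈       = resp (sym (zeroˡ y)) 0∈
      ; +-closed = λ {s} {t} p q → resp (sym (distribʳ y s t)) (+-closed p q)
      ; *-closed = λ x {s} p → resp (sym (*-assoc x s y)) (*-closed x p)
      }

  principal : Carrier → Subset
  principal g x = ∃[ y ] x ≈ g * y

  principal-isIdeal : ∀ g → IsIdeal (principal g)
  principal-isIdeal g = record
    { resp     = λ x≈y (t , x≈gt) → t , trans (sym x≈y) x≈gt
    ; 0∈       = 0# , sym (zeroʳ g)
    ; +-closed = λ (s , p) (t , q) → s + t , trans (+-cong p q) (sym (distribˡ g s t))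
    ; *-closed = λ x (t , p) → x * t ,
        trans (*-congˡ p) (solve 3 (λ x g t → x :* (g :* t) := g :* (x :* t)) refl x g t)
    }

  module _ (I J : Subset) where

    ·-intro : ∀ {x y} → x ∈ I → y ∈ J → x * y ∈ I · J
    ·-intro {x} {y} x∈I y∈J =
      1 , (λ _ → x) , (λ _ → y) , (λ _ → x∈I) , (λ _ → y∈J) , sym (+-identityʳ _)

    ·-least : ∀ {A} → IsIdeal A → (∀ {x y} → x ∈ I → y ∈ J → x * y ∈ A) → I · J ⊆ A
    ·-least isIdeal f (n , a , b , a∈I , b∈J , x≈) =
      IsIdeal.resp isIdeal (sym x≈) (sum-closed isIdeal (λ i → f (a∈I i) (b∈J i)))

    private
      ·-cons : ∀ {x y z} → x ∈ I → y ∈ J → z ∈ I · J → x * y + z ∈ I · J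
      ·-cons {x} {y} x∈I y∈J (n , a , b , a∈I , b∈J , z≈) =
        suc n , (x Vector.∷ a) , (y Vector.∷ b)
        , (λ { zero → x∈I ; (suc i) → a∈I i })
        , (λ { zero → y∈J ; (suc i) → b∈J i })
        , +-congˡ z≈

      ·-resp : ∀ {x y} → x ≈ y → x ∈ I · J → y ∈ I · J
      ·-resp x≈y (n , a , b , a∈I , b∈J , x≈) = n , a , b , a∈I , b∈J , trans (sym x≈y) x≈

      ·-append : ∀ n (a b : Vector Carrier n) → (∀ i → a i ∈ I) → (∀ i → b i ∈ J) →
                 ∀ {z} → z ∈ I · J → sum (λ i → a i * b i) + z ∈ I · J
      ·-append zero    a b a∈I b∈J z∈ = ·-resp (sym (+-identityˡ _)) z∈
      ·-append (suc n) a b a∈I b∈J z∈ = ·-resp (sym (+-assoc _ _ _))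
        (·-cons (a∈I zero) (b∈J zero) (·-append n _ _ (a∈I ∘ suc) (b∈J ∘ suc) z∈))

      ·-scale : ∀ n (a b : Vector Carrier n) → (∀ i → a i ∈ I) → (∀ i → b i ∈ J) →
                IsIdeal J → ∀ x → x * sum (λ i → a i * b i) ∈ I · J
      ·-scale zero    a b a∈I b∈J isJ x = 0 , a , b , a∈I , b∈J , zeroʳ x
      ·-scale (suc n) a b a∈I b∈J isJ x = ·-resp
        (solve 4 (λ x a b s → a :* (x :* b) :+ x :* s := x :* (a :* b :+ s)) refl x _ _ _)
        (·-cons (a∈I zero) (IsIdeal.*-closed isJ x (b∈J zero))
          (·-scale n _ _ (a∈I ∘ suc) (b∈J ∘ suc) isJ x))

    ·-isIdeal : IsIdeal J → IsIdeal (I · J)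
    ·-isIdeal isJ = record
      { resp     = ·-resp
      ; 0∈       = 0 , (λ ()) , (λ ()) , (λ ()) , (λ ()) , refl
      ; +-closed = λ (n , a , b , a∈I , b∈J , x≈) y∈ →
          ·-resp (sym (+-congʳ x≈)) (·-append n a b a∈I b∈J y∈)
      ; *-closed = λ x (n , a , b , a∈I , b∈J , y≈) →
          ·-resp (sym (*-congˡ y≈)) (·-scale n a b a∈I b∈J isJ x)
      }

  U-isIdeal : IsIdeal U
  U-isIdeal = record { resp = λ _ _ → tt ; 0∈ = tt ; +-closed = λ _ _ → tt ; *-closed = λ _ _ → tt }

  ·-mono : ∀ I J J′ → J ⊆ J′ → I · J ⊆ I · J′
  ·-mono I J J′ J⊆J′ (n , a , b , a∈I , b∈J , x≈) = n , a , b , a∈I , (λ i → J⊆J′ (b∈J i)) , x≈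

  module _ {P : Subset} where

    ^ᴵ-isIdeal : ∀ m → IsIdeal (P ^ᴵ m)
    ^ᴵ-isIdeal zero    = U-isIdeal
    ^ᴵ-isIdeal (suc m) = ·-isIdeal P (P ^ᴵ m) (^ᴵ-isIdeal m)

    ^-∈-^ᴵ : ∀ {x} m → x ∈ P → x ^ m ∈ P ^ᴵ m
    ^-∈-^ᴵ zero    x∈P = tt
    ^-∈-^ᴵ (suc m) x∈P = ·-intro P (P ^ᴵ m) x∈P (^-∈-^ᴵ m x∈P)

    ^ᴵ-suc-⊆ : ∀ m → P ^ᴵ suc m ⊆ P ^ᴵ m
    ^ᴵ-suc-⊆ m = ·-least P (P ^ᴵ m) (^ᴵ-isIdeal m) (λ {x} _ → IsIdeal.*-closed (^ᴵ-isIdeal m) x)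

    ^ᴵ-+-⊆ : ∀ k m → P ^ᴵ (k ℕ.+ m) ⊆ P ^ᴵ m
    ^ᴵ-+-⊆ zero    m x∈ = x∈
    ^ᴵ-+-⊆ (suc k) m x∈ = ^ᴵ-+-⊆ k m (^ᴵ-suc-⊆ (k ℕ.+ m) x∈)

    ^ᴵ-⊆ : ∀ {m k} → m ℕ.≤ k → P ^ᴵ k ⊆ P ^ᴵ m
    ^ᴵ-⊆ {m} {k} m≤k {x} x∈ =
      ^ᴵ-+-⊆ (k ℕ.∸ m) m (≡.subst (λ j → x ∈ P ^ᴵ j) (≡.sym (ℕ.m∸n+n≡m m≤k)) x∈)
      where import Data.Nat.Properties as ℕ

    ^ᴵ⊆ : IsIdeal P → ∀ {m} → 1 ℕ.≤ m → P ^ᴵ m ⊆ P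
    ^ᴵ⊆ isP {suc m} _ = ·-least P (P ^ᴵ m) isP (λ {_} {y} x∈P _ → *-closedʳ isP y x∈P)

    -- Multiplication by P carries the inclusion to every later exponent, and the resulting
    -- inclusions compose.
    ^ᴵ-stable : ∀ m → P ^ᴵ m ⊆ P ^ᴵ suc m → ∀ k → P ^ᴵ m ⊆ P ^ᴵ (k ℕ.+ m)
    ^ᴵ-stable m step zero    x∈ = x∈
    ^ᴵ-stable m step (suc k) x∈ = stable k (^ᴵ-stable m step k x∈)
      where
      stable : ∀ k → P ^ᴵ (k ℕ.+ m) ⊆ P ^ᴵ (suc k ℕ.+ m)
      stable zero    = step
      stable (suc k) = ·-mono P (P ^ᴵ (k ℕ.+ m)) (P ^ᴵ (suc k ℕ.+ m)) (stable k)

  -- The innermost factor is `U`, and at each stage sums are concatenated and a scalar is absorbed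
  -- by the right factor; the factors on the left may be arbitrary subsets.
  ∏ᴵ-isIdeal : ∀ {n} (Q : Vector Subset n) → IsIdeal (∏ᴵ Q)
  ∏ᴵ-isIdeal {zero}  Q = U-isIdeal
  ∏ᴵ-isIdeal {suc n} Q = ·-isIdeal (Q zero) (∏ᴵ (Q ∘ suc)) (∏ᴵ-isIdeal (Q ∘ suc))

  ∏ᴵ-intro : ∀ {n} (Q : Vector Subset n) {g : Vector Carrier n} →
             (∀ l → g l ∈ Q l) → product g ∈ ∏ᴵ Q
  ∏ᴵ-intro {zero}  Q g∈Q = tt
  ∏ᴵ-intro {suc n} Q g∈Q =
    ·-intro (Q zero) (∏ᴵ (Q ∘ suc)) (g∈Q zero) (∏ᴵ-intro (Q ∘ suc) (g∈Q ∘ suc))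

  ∏ᴵ-⊆ : ∀ {n} (Q : Vector Subset n) {A} → IsIdeal A → ∀ l → Q l ⊆ A → ∏ᴵ Q ⊆ A
  ∏ᴵ-⊆ {suc n} Q isA zero    Q⊆A = ·-least (Q zero) (∏ᴵ (Q ∘ suc)) isA (λ {_} {y} x∈Q _ → *-closedʳ isA y (Q⊆A x∈Q))
  ∏ᴵ-⊆ {suc n} Q isA (suc l) Q⊆A =
    ·-least (Q zero) (∏ᴵ (Q ∘ suc)) isA (λ {x} _ y∈ → IsIdeal.*-closed isA x (∏ᴵ-⊆ (Q ∘ suc) isA l Q⊆A y∈))

  module _ {P : Subset} (isPrime : IsPrime P) where
    open IsPrime isPrime
    private module P = IsIdeal isIdeal

    1∉ : 1# ∉ P
    1∉ 1∈P = proper (λ x → P.resp (*-identityʳ x) (P.*-closed x 1∈P))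

    *-∉ : ∀ {x y} → x ∉ P → y ∉ P → x * y ∉ P
    *-∉ {x} {y} x∉P y∉P xy∈P = [ x∉P , y∉P ]′ (split x y xy∈P)

    ^-∉ : ∀ {x} m → x ∉ P → x ^ m ∉ P
    ^-∉ zero    x∉P = 1∉
    ^-∉ (suc m) x∉P = *-∉ x∉P (^-∉ m x∉P)

    product-∉ : ∀ {n} {g : Vector Carrier n} → (∀ i → g i ∉ P) → product g ∉ P
    product-∉ {zero}  g∉P = 1∉
    product-∉ {suc n} g∉P = *-∉ (g∉P zero) (product-∉ (g∉P ∘ suc))

    -- In the localisation at P the factors other than `Q l` become the unit ideal, so the product
    -- becomes `Q l`; `t` is the product of the chosen elements outside P. This serves both for K as
    -- a product of prime powers and for the product of the sequences that defines `v`.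
    ∏ᴵ-cofactor : ∀ {n} (Q : Vector Subset n) l →
      (∀ l′ → l′ ≢ l → ∃[ x ] (x ∈ Q l′ × x ∉ P)) →
      ∃[ t ] (t ∉ P × (∀ {x} → x ∈ Q l → t * x ∈ ∏ᴵ Q))
    ∏ᴵ-cofactor {suc n} Q zero pick =
      product x , product-∉ (λ l → proj₂ (proj₂ (pick (suc l) λ ()))) , λ {y} y∈ →
        IsIdeal.resp (∏ᴵ-isIdeal Q) (*-comm y _)
          (·-intro (Q zero) (∏ᴵ (Q ∘ suc)) y∈ (∏ᴵ-intro (Q ∘ suc) (λ l → proj₁ (proj₂ (pick (suc l) λ ())))))
      where
      x : Vector Carrier _
      x l = proj₁ (pick (suc l) λ ())
    ∏ᴵ-cofactor {suc n} Q (suc l) pick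
      with x₀ , x₀∈ , x₀∉ ← pick zero (λ ())
         | t , t∉ , t∈ ← ∏ᴵ-cofactor (Q ∘ suc) l (λ l′ l′≢l → pick (suc l′) (λ { ≡.refl → l′≢l ≡.refl }))
      = x₀ * t , *-∉ x₀∉ t∉ , λ y∈ →
          IsIdeal.resp (∏ᴵ-isIdeal Q) (sym (*-assoc x₀ t _))
            (·-intro (Q zero) (∏ᴵ (Q ∘ suc)) x₀∈ (t∈ y∈))

    -- The contraction to R of the extension of A to the localisation of R at P.
    Loc : Subset → Subset
    Loc A x = ∃[ s ] (s ∉ P × s * x ∈ A)

    Loc-isIdeal : ∀ {A} → IsIdeal A → IsIdeal (Loc A)
    Loc-isIdeal isA = record
      { resp     = λ x≈y (s , s∉ , p) → s , s∉ , A.resp (*-congˡ x≈y) p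
      ; 0∈       = 1# , 1∉ , A.resp (sym (zeroʳ 1#)) A.0∈
      ; +-closed = λ {x} {y} (s , s∉ , p) (t , t∉ , q) → s * t , *-∉ s∉ t∉ ,
          A.resp (solve 4 (λ s t x y → t :* (s :* x) :+ s :* (t :* y) := s :* t :* (x :+ y)) refl s t x y)
                 (A.+-closed (A.*-closed t p) (A.*-closed s q))
      ; *-closed = λ x {y} (s , s∉ , p) → s , s∉ ,
          A.resp (solve 3 (λ s x y → x :* (s :* y) := s :* (x :* y)) refl s x y) (A.*-closed x p)
      }
      where module A = IsIdeal isA

    ⊆Loc : ∀ {A} → IsIdeal A → A ⊆ Loc A
    ⊆Loc isA x∈A = 1# , 1∉ , IsIdeal.*-closed isA 1# x∈A

    Loc-mono : ∀ {A B} → A ⊆ B → Loc A ⊆ Loc B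
    Loc-mono A⊆B (s , s∉ , p) = s , s∉ , A⊆B p

  IsUnitModulo : Subset → Carrier → Set (c ⊔ ℓ)
  IsUnitModulo A s = ∃[ σ ] ∃[ π ] (π ∈ A × s * σ + π ≈ 1#)

  -- Writing the second summand of s σ + π as π · 1 and substituting s σ′ + π ^ m for this 1 raises
  -- the exponent by one while keeping the form of the relation.
  unit-^ : ∀ {P s} → IsUnitModulo P s → ∀ m → IsUnitModulo (P ^ᴵ m) s
  unit-^ {P} {s} (σ , π , π∈P , 1≈) m = proj₁ (go m) , π ^ m , ^-∈-^ᴵ m π∈P , proj₂ (go m)
    where
    open SetoidReasoning setoid
    go : ∀ m → ∃[ σ′ ] s * σ′ + π ^ m ≈ 1#
    go zero    = 0# , trans (+-congʳ (zeroʳ s)) (+-identityˡ 1#)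
    go (suc m) with σ′ , 1≈′ ← go m = σ + π * σ′ , (begin
      s * (σ + π * σ′) + π * π ^ m   ≈⟨ solve 5 (λ s σ π σ′ p → s :* (σ :+ π :* σ′) :+ π :* p := s :* σ :+ π :* (s :* σ′ :+ p)) refl s σ π σ′ (π ^ m) ⟩
      s * σ + π * (s * σ′ + π ^ m)   ≈⟨ +-congˡ (trans (*-congˡ 1≈′) (*-identityʳ π)) ⟩
      s * σ + π                      ≈⟨ 1≈ ⟩
      1#                             ∎)

  cancel-unit : ∀ {A s} → IsIdeal A → IsUnitModulo A s → ∀ {x} → s * x ∈ A → x ∈ A
  cancel-unit {A} {s} isA (σ , π , π∈A , 1≈) {x} sx∈A = A.resp eq
    (A.+-closed (A.*-closed σ sx∈A) (*-closedʳ isA x π∈A))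
    where
    module A = IsIdeal isA
    eq : σ * (s * x) + π * x ≈ x
    eq = trans (solve 4 (λ s σ π x → σ :* (s :* x) :+ π :* x := (s :* σ :+ π) :* x) refl s σ π x)
               (trans (*-congʳ 1≈) (*-identityˡ x))

module Classical {c ℓ} (em : ExcludedMiddle (c ⊔ ℓ)) (R : CommutativeRing c ℓ) where
  open CommutativeRing R hiding (zero)
  open Ideals R

  infix 4 _≈?_
  _≈?_ : ∀ x y → Dec (x ≈ y)
  x ≈? y = map′ lower (lift {ℓ = c}) em

  ⊈⇒∃ : ∀ {A B : Subset} → ¬ A ⊆ B → ∃[ x ] (x ∈ A × x ∉ B)
  ⊈⇒∃ A⊈B = decidable-stable em λ none →
    A⊈B λ {x} x∈A → decidable-stable em λ x∉B → none (x , x∈A , x∉B)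

  nonzero-element : ∀ {A : Subset} → ¬ IsZero A → ∃[ x ] (x ∈ A × ¬ x ≈ 0#)
  nonzero-element A≢0 = decidable-stable em λ none →
    A≢0 λ x x∈A → decidable-stable (x ≈? 0#) λ x≉0 → none (x , x∈A , x≉0)

-- A uniformizer of a Dedekind domain at a nonzero prime

module Uniformizer {c ℓ} (em : ExcludedMiddle (c ⊔ ℓ)) (D : CommutativeRing c ℓ)
  (isDedekind : Ideals.IsDedekindDomain D)
  (P : Ideals.Subset D) (isPrime : Ideals.IsPrime D P)
  (a : CommutativeRing.Carrier D) (a∈P : a ∈ P)
  (a≉0 : ¬ CommutativeRing._≈_ D a (CommutativeRing.0# D)) where

  open CommutativeRing D hiding (zero)
  open Ideals D
  open RawSemiringDefs (Semiring.rawSemiring semiring) using (sum; _^_)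
  open IntegerSolver D
  open IdealProperties D
  open Classical em D
  open IsDedekindDomain isDedekind
  open IsPrime isPrime using (proper; split) renaming (isIdeal to P-isIdeal)
  private module P = IsIdeal P-isIdeal
  open import Algebra.Properties.Semiring.Sum semiring
    using (sum-cong-≋; ∑-distrib-+; *-distribˡ-sum; *-distribʳ-sum)
  open import Algebra.Properties.Semiring.Exp semiring using (^-homo-*; ^-congʳ)
  open SetoidReasoning setoid

  private
    cancel-nonzero : ∀ {x y z} → ¬ z ≈ 0# → x * z ≈ y * z → x ≈ y
    cancel-nonzero {x} {y} {z} z≉0 xz≈yz with proj₂ isIntegralDomain (x - y) z
      (trans (solve 3 (λ x y z → (x :- y) :* z := x :* z :- y :* z) refl x y z)
             (trans (+-congʳ xz≈yz) (-‿inverseʳ _)))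
    ... | inj₁ x-y≈0 = trans (solve 2 (λ x y → x := (x :- y) :+ y) refl x y)
                             (trans (+-congʳ x-y≈0) (+-identityˡ y))
    ... | inj₂ z≈0   = contradiction z≈0 z≉0

  -- By maximality of P the ideal s D + P is P or D, and it contains s.
  ∉⇒unit : ∀ {s} → s ∉ P → IsUnitModulo P s
  ∉⇒unit {s} s∉P with IsMaximal.maximal maximal (λ x → ∃[ σ ] ∃[ π ] (π ∈ P × s * σ + π ≈ x))
    (record
      { resp     = λ x≈y (σ , π , π∈P , eq) → σ , π , π∈P , trans eq x≈y
      ; 0∈       = 0# , 0# , P.0∈ , trans (+-identityʳ _) (zeroʳ s)
      ; +-closed = λ (σ , π , π∈P , eq) (σ′ , π′ , π′∈P , eq′) →
          σ + σ′ , π + π′ , P.+-closed π∈P π′∈P ,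
          trans (solve 5 (λ s σ π σ′ π′ → s :* (σ :+ σ′) :+ (π :+ π′) := (s :* σ :+ π) :+ (s :* σ′ :+ π′)) refl s σ π σ′ π′)
                (+-cong eq eq′)
      ; *-closed = λ x (σ , π , π∈P , eq) → x * σ , x * π , P.*-closed x π∈P ,
          trans (solve 4 (λ x s σ π → s :* (x :* σ) :+ x :* π := x :* (s :* σ :+ π)) refl x s σ π)
                (*-congˡ eq)
      })
    (λ {x} x∈P → 0# , x , x∈P , trans (+-congʳ (zeroʳ s)) (+-identityˡ x))
    where
    maximal : IsMaximal P
    maximal = dimension≤1 P isPrime (λ P≡0 → a≉0 (P≡0 a a∈P))
  ... | inj₁ (⊆P , _) = contradiction
    (⊆P (1# , 0# , P.0∈ , trans (+-identityʳ _) (*-identityʳ s))) s∉P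
  ... | inj₂ whole    = whole 1#

  private
    -- The annihilator (a : b) of the class of b in D / a D.
    colon : Carrier → Subset
    colon b x = ∃[ y ] b * x ≈ a * y

    colon-isIdeal′ : ∀ b → IsIdeal (colon b)
    colon-isIdeal′ b = record
      { resp     = λ x≈y (t , eq) → t , trans (*-congˡ (sym x≈y)) eq
      ; 0∈       = 0# , trans (zeroʳ b) (sym (zeroʳ a))
      ; +-closed = λ (s , p) (t , q) →
          s + t , trans (distribˡ b _ _) (trans (+-cong p q) (sym (distribˡ a s t)))
      ; *-closed = λ x (t , p) → x * t ,
          trans (solve 3 (λ b x y → b :* (x :* y) := x :* (b :* y)) refl b x _)
                (trans (*-congˡ p) (solve 3 (λ x a t → x :* (a :* t) := a :* (x :* t)) refl x a t))
      }

    colon-⊆ : ∀ b s → colon b ⊆ colon (b * s)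
    colon-⊆ b s {x} (y , eq) = s * y , (begin
      b * s * x     ≈⟨ solve 3 (λ b s x → b :* s :* x := s :* (b :* x)) refl b s x ⟩
      s * (b * x)   ≈⟨ *-congˡ eq ⟩
      s * (a * y)   ≈⟨ solve 3 (λ s a y → s :* (a :* y) := a :* (s :* y)) refl s a y ⟩
      a * (s * y)   ∎)

    colon-* : ∀ b s x → x ∈ colon (b * s) → s * x ∈ colon b
    colon-* b s x (y , eq) = y , trans (sym (*-assoc b s x)) eq

    -- Maximality is required among the annihilators inside P only, so that the associated prime
    -- found in this way lies below P.
    IsMaximalColon : Carrier → Set (c ⊔ ℓ)
    IsMaximalColon b = ∀ b′ → colon b ⊆ colon b′ → colon b′ ⊆ P → colon b′ ⊆ colon b

    1⊆P : colon 1# ⊆ P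
    1⊆P {x} (y , eq) = P.resp (trans (sym eq) (*-identityˡ x)) (*-closedʳ P-isIdeal y a∈P)

    module _ (none : ¬ (∃[ b ] (colon b ⊆ P × IsMaximalColon b))) where

      Extension : Carrier → Set (c ⊔ ℓ)
      Extension b = ∃[ b′ ] (colon b′ ⊆ P × colon b ⊆ colon b′ × ∃[ x ] (x ∈ colon b′ × x ∉ colon b))

      extend : ((b , _) : Σ[ b ∈ Carrier ] colon b ⊆ P) → Extension b
      extend (b , b⊆P) with em {Extension b}
      ... | yes ext  = ext
      ... | no noext = ⊥-elim (none (b , b⊆P , λ b′ b⊆b′ b′⊆P {x} x∈ →
        decidable-stable em λ x∉ → noext (b′ , b′⊆P , b⊆b′ , x , x∈ , x∉)))

      chain : ℕ → Σ[ b ∈ Carrier ] colon b ⊆ P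
      chain = fold (1# , 1⊆P) λ b → let b′ , b′⊆P , _ = extend b in b′ , λ {_} → b′⊆P

      ¬none : ⊥
      ¬none with n , stable ← isNoetherian (λ k → colon (proj₁ (chain k))) (λ k → colon-isIdeal′ _)
                                (λ k → proj₁ (proj₂ (proj₂ (extend (chain k)))))
        = proj₂ (proj₂ (proj₂ (proj₂ (proj₂ (extend (chain n)))))) (stable (suc n) (ℕ.n≤1+n n)
          (proj₁ (proj₂ (proj₂ (proj₂ (proj₂ (extend (chain n))))))))

    -- Otherwise each annihilator inside P is strictly contained in another one, and iteration from
    -- `colon 1#`, which is a D, gives an ascending chain that never becomes stationary.
    ∃maximalColon : ∃[ b ] (colon b ⊆ P × IsMaximalColon b)
    ∃maximalColon = decidable-stable em ¬none

    -- Let x y ∈ (a : b), so that x ∈ (a : b y). If (a : b y) lies in P, it equals (a : b) by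
    -- maximality, and x ∈ (a : b). Otherwise it contains some s ∉ P; then s y ∈ (a : b), and s can
    -- be cancelled.
    colon-isPrime : ∀ b → colon b ⊆ P → IsMaximalColon b → IsPrime (colon b)
    colon-isPrime b b⊆P maximal = record
      { isIdeal = colon-isIdeal′ b
      ; proper  = λ whole → proper (λ x → b⊆P (whole x))
      ; split   = split-colon
      }
      where
      -- Multiplying b by an element outside P does not enlarge (a : b).
      cancel : ∀ {s y} → s ∉ P → s * y ∈ colon b → y ∈ colon b
      cancel {s} {y} s∉P (z , eq) = maximal (b * s) (colon-⊆ b s)
        (λ {u} u∈ → [ (λ s∈P → contradiction s∈P s∉P) , id ]′ (split s u (b⊆P (colon-* b s u u∈))))
        (z , trans (*-assoc b s y) eq)

      split-colon : ∀ x y → x * y ∈ colon b → x ∈ colon b ⊎ y ∈ colon b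
      split-colon x y (z , eq) with em {colon (b * y) ⊆ P}
      ... | yes ⊆P = inj₁ (maximal (b * y) (colon-⊆ b y) ⊆P
              (z , trans (solve 3 (λ b x y → b :* y :* x := b :* (x :* y)) refl b x y) eq))
      ... | no ⊈P with s , s∈ , s∉P ← ⊈⇒∃ ⊈P = inj₂ (cancel s∉P
              (IsIdeal.resp (colon-isIdeal′ b) (*-comm y s) (colon-* b y s s∈)))

  -- P is an associated prime of D / a.
  ∃annihilator : ∃[ b ] (¬ (∃[ t ] b ≈ a * t) × (∀ {x} → x ∈ P → ∃[ y ] b * x ≈ a * y))
  ∃annihilator with b , b⊆P , maximal ← ∃maximalColon =
    b , (λ (t , b≈at) → 1∉ isPrime (b⊆P (t , trans (*-identityʳ b) b≈at))) , P⊆colon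
    where
    prime : IsPrime (colon b)
    prime = colon-isPrime b b⊆P maximal
    P⊆colon : P ⊆ colon b
    -- The element `a` belongs to `colon b`, so this prime is nonzero and hence maximal; being
    -- contained in the proper ideal P, it equals P.
    P⊆colon with IsMaximal.maximal (dimension≤1 (colon b) prime (λ colon≡0 → a≉0 (colon≡0 a (b , *-comm b a))))
               P P-isIdeal b⊆P
    ... | inj₁ (P⊆colon , _) = P⊆colon
    ... | inj₂ whole     = contradiction whole proper

  private
    -- `sum` unfolds at the first index, whereas the spans below grow at the last one. Taking `h` on
    -- ℕ lets both sums use the same function.
    snoc : ∀ n (cs : Vector Carrier n) x → Σ[ cs′ ∈ Vector Carrier (suc n) ] (∀ (h : ℕ → Carrier) →
      sum {suc n} (λ i → cs′ i * h (toℕ i)) ≈ sum (λ i → cs i * h (toℕ i)) + x * h n)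
    snoc zero    cs x = (λ _ → x) , λ h → +-comm _ 0#
    snoc (suc n) cs x with cs′ , eq ← snoc n (cs ∘ suc) x =
      (cs zero Vector.∷ cs′) , λ h → trans (+-congˡ (eq (h ∘ suc))) (sym (+-assoc _ _ _))

  module _ (b : Carrier) (b∤ : ¬ (∃[ t ] b ≈ a * t)) where

    -- If γ = b / a maps P into itself, then the D-module spanned by the elements
    -- γⁱ a of P is finitely generated, and γ is integral.
    ¬stable : ¬ (∀ {x} → x ∈ P → ∃[ y ] (y ∈ P × b * x ≈ a * y))
    ¬stable γP⊆P = b∤ (from-∣ (isIntegrallyClosed b a a≉0 (suc n) (λ i → - cs i) monic))
      where
      -- `g k` is γᵏ a, with division by a avoided: the next term is the element y of P with b * g k
      -- ≈ a * y.
      orbit : ℕ → Σ[ x ∈ Carrier ] x ∈ P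
      orbit = fold (a , a∈P) (λ (x , x∈P) → proj₁ (γP⊆P x∈P) , proj₁ (proj₂ (γP⊆P x∈P)))

      g : ℕ → Carrier
      g k = proj₁ (orbit k)

      g-suc : ∀ k → b * g k ≈ a * g (suc k)
      g-suc k = proj₂ (proj₂ (γP⊆P (proj₂ (orbit k))))

      a^k*g : ∀ k → a ^ k * g k ≈ b ^ k * a
      a^k*g zero    = refl
      a^k*g (suc k) = begin
        a * a ^ k * g (suc k)     ≈⟨ solve 3 (λ a p g → a :* p :* g := p :* (a :* g)) refl a (a ^ k) _ ⟩
        a ^ k * (a * g (suc k))   ≈⟨ *-congˡ (g-suc k) ⟨
        a ^ k * (b * g k)         ≈⟨ solve 3 (λ p b g → p :* (b :* g) := b :* (p :* g)) refl (a ^ k) b _ ⟩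
        b * (a ^ k * g k)         ≈⟨ *-congˡ (a^k*g k) ⟩
        b * (b ^ k * a)           ≈⟨ *-assoc b _ a ⟨
        b * b ^ k * a             ∎

      combination : ∀ {n} → Vector Carrier (suc n) → Carrier
      combination {n} cs = sum {suc n} (λ i → cs i * g (toℕ i))

      0-combination : ∀ n → combination {n} (λ _ → 0#) ≈ 0#
      0-combination n = trans (sym (*-distribˡ-sum {suc n} 0# (λ i → g (toℕ i)))) (zeroˡ _)

      -- The module spanned by the γⁱ a with i ≤ n consists of elements of D, so it is an ideal and
      -- the ascending chain condition of D applies.
      span : ℕ → Subset
      span n x = Σ[ cs ∈ Vector Carrier (suc n) ] x ≈ combination cs

      span-isIdeal : ∀ n → IsIdeal (span n)
      span-isIdeal n = record
        { resp     = λ x≈y (cs , eq) → cs , trans (sym x≈y) eq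
        ; 0∈       = (λ _ → 0#) , sym (0-combination n)
        ; +-closed = λ (cs , p) (ds , q) → (λ i → cs i + ds i) ,
            trans (+-cong p q) (trans (sym (∑-distrib-+ {suc n} (λ i → cs i * g (toℕ i)) (λ i → ds i * g (toℕ i))))
              (sum-cong-≋ {suc n} (λ i → sym (distribʳ (g (toℕ i)) (cs i) (ds i)))))
        ; *-closed = λ x (cs , p) → (λ i → x * cs i) ,
            trans (*-congˡ p) (trans (*-distribˡ-sum {suc n} x (λ i → cs i * g (toℕ i)))
              (sum-cong-≋ {suc n} (λ i → sym (*-assoc x (cs i) (g (toℕ i))))))
        }

      span-suc : ∀ n → span n ⊆ span (suc n)
      span-suc n (cs , eq) with cs′ , eq′ ← snoc (suc n) cs 0# =
        cs′ , trans eq (sym (trans (eq′ g) (trans (+-congˡ (zeroˡ _)) (+-identityʳ _))))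

      last∈span : ∀ n → g n ∈ span n
      last∈span zero    = (λ _ → 1#) , sym (trans (+-identityʳ _) (*-identityˡ _))
      last∈span (suc n) with cs′ , eq′ ← snoc (suc n) (λ _ → 0#) 1# =
        cs′ , sym (trans (eq′ g) (trans (+-cong (0-combination n) (*-identityˡ _)) (+-identityˡ _)))

      noetherian : ∃[ n ] (∀ m → n ℕ.≤ m → span m ⊆ span n)
      noetherian = isNoetherian span span-isIdeal span-suc

      n : ℕ
      n = proj₁ noetherian

      last∈ : g (suc n) ∈ span n
      last∈ = proj₂ noetherian (suc n) (ℕ.n≤1+n n)
        (last∈span (suc n))

      cs : Vector Carrier (suc n)
      cs = proj₁ last∈

      term : ∀ i → a ^ suc n * (cs i * g (toℕ i)) ≈ cs i * (b ^ toℕ i * a ^ (suc n ℕ.∸ toℕ i)) * a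
      term i = begin
        a ^ suc n * (cs i * g k)                           ≈⟨ *-congʳ (^-congʳ a (ℕ.m∸n+n≡m (ℕ.<⇒≤ (Fin.toℕ<n i)))) ⟨
        a ^ (suc n ℕ.∸ k ℕ.+ k) * (cs i * g k)             ≈⟨ *-congʳ (^-homo-* a (suc n ℕ.∸ k) k) ⟩
        a ^ (suc n ℕ.∸ k) * a ^ k * (cs i * g k)           ≈⟨ solve 4 (λ p q c g → p :* q :* (c :* g) := c :* (p :* (q :* g))) refl (a ^ (suc n ℕ.∸ k)) (a ^ k) (cs i) (g k) ⟩
        cs i * (a ^ (suc n ℕ.∸ k) * (a ^ k * g k))         ≈⟨ *-congˡ (*-congˡ (a^k*g k)) ⟩
        cs i * (a ^ (suc n ℕ.∸ k) * (b ^ k * a))           ≈⟨ solve 4 (λ p q c a → c :* (p :* (q :* a)) := c :* (q :* p) :* a) refl (a ^ (suc n ℕ.∸ k)) (b ^ k) (cs i) a ⟩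
        cs i * (b ^ k * a ^ (suc n ℕ.∸ k)) * a             ∎
        where k = toℕ i

      -- The dependence of γⁿ⁺¹ a on the lower γⁱ a, multiplied by a ^ suc n and divided by a, takes
      -- the homogeneous form in which integral closedness is stated.
      relation : b ^ suc n ≈ sum (λ i → cs i * (b ^ toℕ i * a ^ (suc n ℕ.∸ toℕ i)))
      relation = cancel-nonzero a≉0 (begin
        b ^ suc n * a                                       ≈⟨ a^k*g (suc n) ⟨
        a ^ suc n * g (suc n)                               ≈⟨ *-congˡ (proj₂ last∈) ⟩
        a ^ suc n * sum (λ i → cs i * g (toℕ i))            ≈⟨ *-distribˡ-sum {suc n} (a ^ suc n) (λ i → cs i * g (toℕ i)) ⟩
        sum (λ i → a ^ suc n * (cs i * g (toℕ i)))          ≈⟨ sum-cong-≋ {suc n} term ⟩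
        sum (λ i → cs i * (b ^ toℕ i * a ^ (suc n ℕ.∸ toℕ i)) * a) ≈⟨ *-distribʳ-sum {suc n} a (λ i → cs i * (b ^ toℕ i * a ^ (suc n ℕ.∸ toℕ i))) ⟨
        sum (λ i → cs i * (b ^ toℕ i * a ^ (suc n ℕ.∸ toℕ i))) * a ∎)

      monic : b ^ suc n + sum (λ i → - cs i * (b ^ toℕ i * a ^ (suc n ℕ.∸ toℕ i))) ≈ 0#
      monic = begin
        b ^ suc n + sum (λ i → - cs i * h i)          ≈⟨ +-congʳ relation ⟩
        sum (λ i → cs i * h i) + sum (λ i → - cs i * h i) ≈⟨ ∑-distrib-+ {suc n} (λ i → cs i * h i) (λ i → - cs i * h i) ⟨
        sum (λ i → cs i * h i + - cs i * h i)         ≈⟨ sum-cong-≋ {suc n} (λ i → solve 2 (λ x y → x :* y :+ (:- x) :* y := con (+ 0) :* y) refl (cs i) (h i)) ⟩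
        sum (λ i → 0# * h i)                          ≈⟨ *-distribˡ-sum {suc n} 0# h ⟨
        0# * sum h                                    ≈⟨ zeroˡ _ ⟩
        0#                                            ∎
        where
        h : Vector Carrier (suc n)
        h i = b ^ toℕ i * a ^ (suc n ℕ.∸ toℕ i)

      open RawMagmaDefs *-rawMagma using (_∣_; _,_)
      from-∣ : a ∣ b → ∃[ t ] b ≈ a * t
      from-∣ (t , eq) = t , trans (sym eq) (*-comm t a)

  -- The maximal ideal of the localisation of D at P is generated by q.
  ∃uniformizer : ∃[ q ] ∃[ u ] (q ∈ P × u ∉ P × (∀ {x} → x ∈ P → ∃[ y ] u * x ≈ q * y))
  ∃uniformizer with b , b∤ , bP⊆a ← ∃annihilator = decidable-stable em λ none →
    -- Suppose that no uniformizer exists. For q ∈ P and b q = a u, the element u must lie in P: if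
    -- it did not, u x a = x b q = q a y would give u x = q y for all x ∈ P. Hence γ maps P into
    -- itself.
    ¬stable b b∤ λ {q} q∈P → let u , bq≈au = bP⊆a q∈P in
      u , decidable-stable em (λ u∉P → none (q , u , q∈P , u∉P , λ {x} x∈P →
        let y , bx≈ay = bP⊆a x∈P in y , cancel-nonzero a≉0 (begin
          u * x * a     ≈⟨ solve 3 (λ u x a → u :* x :* a := x :* (a :* u)) refl u x a ⟩
          x * (a * u)   ≈⟨ *-congˡ bq≈au ⟨
          x * (b * q)   ≈⟨ solve 3 (λ x b q → x :* (b :* q) := q :* (b :* x)) refl x b q ⟩
          q * (b * x)   ≈⟨ *-congˡ bx≈ay ⟩
          q * (a * y)   ≈⟨ solve 3 (λ q a y → q :* (a :* y) := q :* y :* a) refl q a y ⟩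
          q * y * a     ∎))) , bq≈au

-- The localisation of R at P is a chain ring: its maximal ideal is generated
-- by q, and the e-th power of its maximal ideal is 0.
record IsChainPrime {c ℓ} (R : CommutativeRing c ℓ) (P : Ideals.Subset R) (e : ℕ) : Set (c ⊔ ℓ) where
  open CommutativeRing R
  open Ideals R
  open IdealProperties R using (IsUnitModulo)
  field
    isPrime : IsPrime P
    ∉⇒unit  : ∀ {s} → s ∉ P → IsUnitModulo P s
    q u t   : Carrier
    q∈P     : q ∈ P
    u∉P     : u ∉ P
    t∉P     : t ∉ P
    uP⊆qR   : ∀ {x} → x ∈ P → ∃[ y ] u * x ≈ q * y
    tPᵉ≈0   : ∀ {x} → x ∈ P ^ᴵ e → t * x ≈ 0#

module Zero {c ℓ} (R : CommutativeRing c ℓ) where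
  open CommutativeRing R
  open Ideals R

  zeroIdeal : Subset
  zeroIdeal x = Lift c (x ≈ 0#)

  zeroIdeal-isIdeal : IsIdeal zeroIdeal
  zeroIdeal-isIdeal = record
    { resp     = λ x≈y (lift p) → lift (trans (sym x≈y) p)
    ; 0∈       = lift refl
    ; +-closed = λ (lift p) (lift q) → lift (trans (+-cong p q) (+-identityˡ 0#))
    ; *-closed = λ x (lift p) → lift (trans (*-congˡ p) (zeroʳ x))
    }

-- Divisibility in the localisation at a chain prime

module ChainPrime {c ℓ} (em : ExcludedMiddle (c ⊔ ℓ)) (R : CommutativeRing c ℓ)
  {P : Ideals.Subset R} {e : ℕ} (isChainPrime : IsChainPrime R P e) where

  open CommutativeRing R hiding (zero)
  open Ideals R
  open RawSemiringDefs (Semiring.rawSemiring semiring) using (_^_)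
  open IntegerSolver R
  open IdealProperties R
  open Zero R
  open Classical em R
  open IsChainPrime isChainPrime
  open IsPrime isPrime using () renaming (isIdeal to P-isIdeal)
  open SetoidReasoning setoid

  -- The kernel of the map from R to its localisation at P: congruence modulo `L` is equality in the
  -- localisation.
  L : Subset
  L = Loc isPrime zeroIdeal

  L-isIdeal : IsIdeal L
  L-isIdeal = Loc-isIdeal isPrime zeroIdeal-isIdeal

  ∉⇒unit-^ : ∀ {s} → s ∉ P → ∀ m → IsUnitModulo (P ^ᴵ m) s
  ∉⇒unit-^ s∉P = unit-^ (∉⇒unit s∉P)

  -- Powers of a maximal ideal are primary: an element outside P is a unit modulo each of them.
  ^ᴵ-cancel : ∀ {s x} → s ∉ P → ∀ m → s * x ∈ P ^ᴵ m → x ∈ P ^ᴵ m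
  ^ᴵ-cancel s∉P m = cancel-unit (^ᴵ-isIdeal m) (∉⇒unit-^ s∉P m)

  Pᵉ⊆L : P ^ᴵ e ⊆ L
  Pᵉ⊆L x∈ = t , t∉P , lift (tPᵉ≈0 x∈)

  -- The product t x is 0, which lies in every power, and t ∉ P can be cancelled. So the powers of P
  -- do not decrease beyond the exponent e.
  Pᵉ⊆Pᵐ : ∀ m → P ^ᴵ e ⊆ P ^ᴵ m
  Pᵉ⊆Pᵐ m x∈ = ^ᴵ-cancel t∉P m (resp (sym (tPᵉ≈0 x∈)) 0∈)
    where open IsIdeal (^ᴵ-isIdeal {P} m)

  ∈^ᴵ⇒∣ : ∀ m {x} → x ∈ P ^ᴵ m → ∃[ y ] u ^ m * x ≈ q ^ m * y
  ∈^ᴵ⇒∣ zero    {x} x∈ = x , refl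
  ∈^ᴵ⇒∣ (suc m)     x∈ = ·-least P (P ^ᴵ m) {λ x → u ^ suc m * x ∈ principal (q ^ suc m)}
    (record
      { resp     = λ x≈y → resp (*-congˡ x≈y)
      ; 0∈       = resp (sym (zeroʳ _)) 0∈
      ; +-closed = λ p q → resp (sym (distribˡ _ _ _)) (+-closed p q)
      ; *-closed = λ x {y} p → resp
          (solve 3 (λ u x y → x :* (u :* y) := u :* (x :* y)) refl (u ^ suc m) x y) (*-closed x p)
      })
    (λ {x} {y} x∈P y∈ → let x′ , p = uP⊆qR x∈P ; y′ , p′ = ∈^ᴵ⇒∣ m y∈ in x′ * y′ , (begin
      u * u ^ m * (x * y)      ≈⟨ solve 4 (λ u v x y → u :* v :* (x :* y) := u :* x :* (v :* y)) refl u (u ^ m) x y ⟩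
      u * x * (u ^ m * y)      ≈⟨ *-cong p p′ ⟩
      q * x′ * (q ^ m * y′)    ≈⟨ solve 4 (λ u v x y → u :* x :* (v :* y) := u :* v :* (x :* y)) refl q (q ^ m) x′ y′ ⟩
      q * q ^ m * (x′ * y′)    ∎))
    x∈
    where open IsIdeal (principal-isIdeal (q ^ suc m))

  -- The search can stop at e: an element of the e-th power lies in all powers, and all later powers
  -- are equal to it.
  ∃highestPower : ∀ d → ∃[ m ] IsHighestPower P d m
  ∃highestPower d = [ (λ d∈Pᵉ → e , d∈Pᵉ , λ m′ _ {x} → Pᵉ⊆Pᵐ m′ {x})
                    , (λ (m , d∈ , d∉) → m , d∈ , highest m d∉)
                    ]′ (search e)
    where
    search : ∀ k → d ∈ P ^ᴵ k ⊎ ∃[ m ] (d ∈ P ^ᴵ m × d ∉ P ^ᴵ suc m)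
    search zero    = inj₁ tt
    search (suc k) with search k | em {d ∈ P ^ᴵ suc k}
    ... | inj₂ found | _       = inj₂ found
    ... | inj₁ d∈    | yes d∈′ = inj₁ d∈′
    ... | inj₁ d∈    | no d∉   = inj₂ (k , d∈ , d∉)

    highest : ∀ m → d ∉ P ^ᴵ suc m → ∀ m′ → d ∈ P ^ᴵ m′ → P ^ᴵ m ⊆ P ^ᴵ m′
    highest m d∉ m′ d∈ with m′ ℕ.≤? m
    ... | yes m′≤m = ^ᴵ-⊆ m′≤m
    ... | no m′≰m  = contradiction (^ᴵ-⊆ (ℕ.≰⇒> m′≰m) d∈) d∉

  self∈w : ∀ d → d ∈ w P d
  self∈w d with d ≈? 0#
  ... | yes d≈0 = inj₁ (d≈0 , d≈0)
  ... | no d≉0  = let m , highest = ∃highestPower d in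
                  inj₂ (d≉0 , m , highest , proj₁ highest)

  ∃^∈w : ∀ {d x} → ¬ d ≈ 0# → x ∈ P → ∃[ m ] x ^ m ∈ w P d
  ∃^∈w {d} d≉0 x∈P = let m , highest = ∃highestPower d in
    m , inj₂ (d≉0 , m , highest , ^-∈-^ᴵ m x∈P)

  -- Up to powers of the unit u, d = qᵐ y and z = qᵐ r in the localisation. If y ∉ P, then y is a
  -- unit there and d divides z. If y ∈ P, then d lies in the next power of P, so by the choice of m
  -- the powers are constant from m on; z is then in the e-th power, which is 0 in the localisation.
  w⇒∣ : ∀ {d z} → z ∈ w P d → ∃[ y ] z - d * y ∈ L
  w⇒∣ {d} {z} (inj₁ (_ , z≈0)) = 0# , resp
    (trans (sym z≈0) (solve 2 (λ z d → z := z :- d :* con (+ 0)) refl z d)) 0∈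
    where open IsIdeal L-isIdeal
  w⇒∣ {d} {z} (inj₂ (_ , m , (d∈ , highest) , z∈))
    with y , uᵐd≈qᵐy ← ∈^ᴵ⇒∣ m d∈ | r , uᵐz≈qᵐr ← ∈^ᴵ⇒∣ m z∈ | em {y ∈ P}
  ... | yes y∈P = 0# , L.resp (solve 2 (λ z d → z := z :- d :* con (+ 0)) refl z d) (Pᵉ⊆L z∈Pᵉ)
    where
    module L = IsIdeal L-isIdeal
    d∈P^suc : d ∈ P ^ᴵ suc m
    d∈P^suc = ^ᴵ-cancel (^-∉ isPrime m u∉P) (suc m) (IsIdeal.resp (^ᴵ-isIdeal (suc m))
      (trans (*-comm y (q ^ m)) (sym uᵐd≈qᵐy)) (·-intro P (P ^ᴵ m) y∈P (^-∈-^ᴵ m q∈P)))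
    z∈Pᵉ : z ∈ P ^ᴵ e
    z∈Pᵉ = ^ᴵ-⊆ (ℕ.m≤m+n e m) (^ᴵ-stable m (highest (suc m) d∈P^suc) e z∈)
  -- `σ` inverts `y * u ^ m` modulo the e-th power of P, so the witness is r / y in the
  -- localisation.
  ... | no y∉P with σ , π , π∈ , 1≈ ← ∉⇒unit-^ (*-∉ isPrime y∉P (^-∉ isPrime m u∉P)) e =
    σ * (u ^ m * r) , L.resp eq (*-closedʳ L-isIdeal z (Pᵉ⊆L π∈))
    where
    module L = IsIdeal L-isIdeal
    v = u ^ m
    eq : π * z ≈ z - d * (σ * (v * r))
    eq = sym (begin
      z - d * (σ * (v * r))                          ≈⟨ +-congʳ (trans (sym (*-identityˡ z)) (*-congʳ (sym 1≈))) ⟩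
      (y * v * σ + π) * z - d * (σ * (v * r))        ≈⟨ solve 7 (λ z d σ v r y π → (y :* v :* σ :+ π) :* z :- d :* (σ :* (v :* r)) := π :* z :+ σ :* (y :* (v :* z) :- r :* (v :* d))) refl z d σ v r y π ⟩
      π * z + σ * (y * (v * z) - r * (v * d))        ≈⟨ +-congˡ (*-congˡ (+-cong (*-congˡ uᵐz≈qᵐr) (-‿cong (*-congˡ uᵐd≈qᵐy)))) ⟩
      π * z + σ * (y * (q ^ m * r) - r * (q ^ m * y)) ≈⟨ solve 6 (λ π z σ y k r → π :* z :+ σ :* (y :* (k :* r) :- r :* (k :* y)) := π :* z) refl π z σ y (q ^ m) r ⟩
      π * z                                          ∎)

-- Finite sums over intervals and boxes

module FiniteSums {c ℓ} (R : CommutativeRing c ℓ) where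
  open CommutativeRing R hiding (zero)
  open IntegerSolver R
  open SetoidReasoning setoid
  open RawSemiringDefs (Semiring.rawSemiring semiring) using (product)
  open import Algebra.Properties.CommutativeSemigroup +-commutativeSemigroup using (interchange)

  -- The last term is split off, which exposes the leading term of a Newton expansion.
  ∑< : ℕ → (ℕ → Carrier) → Carrier
  ∑< zero    g = 0#
  ∑< (suc n) g = ∑< n g + g n

  ∑<-cong : ∀ n {g h} → (∀ j → j ℕ.< n → g j ≈ h j) → ∑< n g ≈ ∑< n h
  ∑<-cong zero    g≈h = refl
  ∑<-cong (suc n) g≈h = +-cong (∑<-cong n λ j j<n → g≈h j (ℕ.m<n⇒m<1+n j<n)) (g≈h n ℕ.≤-refl)

  ∑<-+ : ∀ n g h → ∑< n (λ j → g j + h j) ≈ ∑< n g + ∑< n h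
  ∑<-+ zero    g h = sym (+-identityˡ 0#)
  ∑<-+ (suc n) g h = trans (+-congʳ (∑<-+ n g h)) (interchange _ _ _ _)

  ∑<-*ʳ : ∀ n g y → ∑< n (λ j → g j * y) ≈ ∑< n g * y
  ∑<-*ʳ zero    g y = sym (zeroˡ y)
  ∑<-*ʳ (suc n) g y = trans (+-congʳ (∑<-*ʳ n g y)) (sym (distribʳ y _ _))

  ∑<-extend : ∀ {m n} g → m ℕ.≤ n → (∀ j → m ℕ.≤ j → g j ≈ 0#) → ∑< m g ≈ ∑< n g
  ∑<-extend {m} {n} g m≤n g≈0 = go (ℕ.≤⇒≤′ m≤n)
    where
    go : ∀ {n} → m ℕ.≤′ n → ∑< m g ≈ ∑< n g
    go ℕ.≤′-refl       = refl
    go (ℕ.≤′-step m≤n) = trans (go m≤n)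
      (sym (trans (+-congˡ (g≈0 _ (ℕ.≤′⇒≤ m≤n))) (+-identityʳ _)))

  ∑box : ∀ r → ℕ → (Vec ℕ r → Carrier) → Carrier
  ∑box zero    N g = g []
  ∑box (suc r) N g = ∑< N λ j → ∑box r N λ k → g (j ∷ k)

  ∑box-cong : ∀ r N {g h} → (∀ k → (∀ i → lookup k i ℕ.< N) → g k ≈ h k) → ∑box r N g ≈ ∑box r N h
  ∑box-cong zero    N g≈h = g≈h [] λ ()
  ∑box-cong (suc r) N g≈h = ∑<-cong N λ j j<N → ∑box-cong r N λ k k<N →
    g≈h (j ∷ k) λ { zero → j<N ; (suc i) → k<N i }

  ∑box-+ : ∀ r N g h → ∑box r N (λ k → g k + h k) ≈ ∑box r N g + ∑box r N h
  ∑box-+ zero    N g h = refl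
  ∑box-+ (suc r) N g h = trans (∑<-cong N λ j _ → ∑box-+ r N _ _) (∑<-+ N _ _)

  ∑box-*ʳ : ∀ r N g y → ∑box r N (λ k → g k * y) ≈ ∑box r N g * y
  ∑box-*ʳ zero    N g y = refl
  ∑box-*ʳ (suc r) N g y = trans (∑<-cong N λ j _ → ∑box-*ʳ r N _ y) (∑<-*ʳ N _ y)

  ∑box-difference : ∀ r N (g h m : Vec ℕ r → Carrier) →
    ∑box r N (λ k → g k * m k) - ∑box r N (λ k → h k * m k) ≈ ∑box r N (λ k → (g k - h k) * m k)
  ∑box-difference r N g h m = begin
    ∑box r N (λ k → g k * m k) - Σh
      ≈⟨ +-congʳ (∑box-cong r N λ k _ → solve 3 (λ g h m → g :* m := (g :- h) :* m :+ h :* m) refl (g k) (h k) (m k)) ⟩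
    ∑box r N (λ k → (g k - h k) * m k + h k * m k) - Σh
      ≈⟨ +-congʳ (∑box-+ r N _ _) ⟩
    Σd + Σh - Σh
      ≈⟨ solve 2 (λ d h → d :+ h :- h := d) refl Σd Σh ⟩
    Σd ∎
    where
    Σd = ∑box r N (λ k → (g k - h k) * m k)
    Σh = ∑box r N (λ k → h k * m k)

  ∑box-0 : ∀ r N {g} → (∀ k → g k ≈ 0#) → ∑box r N g ≈ 0#
  ∑box-0 r N {g} g≈0 = trans (∑box-cong r N λ k _ → trans (g≈0 k) (sym (zeroʳ 0#)))
    (trans (∑box-*ʳ r N (λ _ → 0#) 0#) (zeroʳ _))

  ∑box-extend : ∀ r {M N} g → M ℕ.≤ N → (∀ k → ¬ (∀ i → lookup k i ℕ.< M) → g k ≈ 0#) →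
                ∑box r M g ≈ ∑box r N g
  ∑box-extend zero    g M≤N g≈0 = refl
  ∑box-extend (suc r) {M} {N} g M≤N g≈0 = trans
    (∑<-cong M λ j _ → ∑box-extend r (λ k → g (j ∷ k)) M≤N λ k k≮M → g≈0 (j ∷ k) λ p → k≮M (p ∘ suc))
    (∑<-extend _ M≤N λ j M≤j → ∑box-0 r N λ k → g≈0 (j ∷ k) λ p → ℕ.<⇒≱ (p zero) M≤j)

  ∑box-product : ∀ r N (g : Fin r → ℕ → Carrier) →
    ∑box r N (λ k → product (λ i → g i (lookup k i))) ≈ product (λ i → ∑< N (g i))
  ∑box-product zero    N g = refl
  ∑box-product (suc r) N g = begin
    ∑< N (λ j → ∑box r N (λ k → g zero j * Π k))      ≈⟨ ∑<-cong N (λ j _ → trans (∑box-cong r N λ k _ → *-comm _ _) (∑box-*ʳ r N Π (g zero j))) ⟩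
    ∑< N (λ j → ∑box r N Π * g zero j)                ≈⟨ ∑<-cong N (λ j _ → *-comm _ _) ⟩
    ∑< N (λ j → g zero j * ∑box r N Π)                ≈⟨ ∑<-*ʳ N (g zero) _ ⟩
    ∑< N (g zero) * ∑box r N Π                        ≈⟨ *-congˡ (∑box-product r N (g ∘ suc)) ⟩
    ∑< N (g zero) * product (λ i → ∑< N (g (suc i)))  ∎
    where
    Π : Vec ℕ r → Carrier
    Π k = product (λ i → g (suc i) (lookup k i))

  ∑ˡ : ∀ {a} {A : Set a} → (A → Carrier) → List A → Carrier
  ∑ˡ g ks = List.foldr _+_ 0# (List.map g ks)

  ∑ˡ-++ : ∀ {a} {A : Set a} (g : A → Carrier) xs ys → ∑ˡ g (xs ++ ys) ≈ ∑ˡ g xs + ∑ˡ g ys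
  ∑ˡ-++ g []       ys = sym (+-identityˡ _)
  ∑ˡ-++ g (x ∷ xs) ys = trans (+-congˡ (∑ˡ-++ g xs ys)) (sym (+-assoc _ _ _))

  ∑ˡ-upTo : ∀ g n → ∑ˡ g (List.upTo n) ≈ ∑< n g
  ∑ˡ-upTo g zero    = refl
  ∑ˡ-upTo g (suc n) = begin
    ∑ˡ g (List.upTo (suc n))               ≡⟨ ≡.cong (∑ˡ g) (List.upTo-∷ʳ n) ⟨
    ∑ˡ g (List.upTo n ++ n ∷ [])           ≈⟨ ∑ˡ-++ g (List.upTo n) (n ∷ []) ⟩
    ∑ˡ g (List.upTo n) + (g n + 0#)        ≈⟨ +-cong (∑ˡ-upTo g n) (+-identityʳ (g n)) ⟩
    ∑< n g + g n                           ∎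

  ∑ˡ-box : ∀ r N g → ∑ˡ g (box r N) ≈ ∑box r N g
  ∑ˡ-box zero    N g = +-identityʳ _
  ∑ˡ-box (suc r) N g = trans (rows (List.upTo N))
    (trans (∑ˡ-upTo _ N) (∑<-cong N λ j _ → ∑ˡ-box r N (λ k → g (j ∷ k))))
    where
    rows : ∀ js → ∑ˡ g (List.cartesianProductWith _∷_ js (box r N)) ≈
                  ∑ˡ (λ j → ∑ˡ (λ k → g (j ∷ k)) (box r N)) js
    rows []       = refl
    rows (j ∷ js) = trans (∑ˡ-++ g (List.map (j ∷_) (box r N)) _)
      (+-cong (reflexive (≡.cong (List.foldr _+_ 0#) (≡.sym (List.map-∘ (box r N))))) (rows js))

module IdealSums {c ℓ} (R : CommutativeRing c ℓ) {A : Ideals.Subset R} (isIdeal : Ideals.IsIdeal R A) where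
  open CommutativeRing R hiding (zero)
  open IntegerSolver R
  open FiniteSums R
  open Ideals.IsIdeal isIdeal

  ∑box-closed : ∀ r N {g} → (∀ k → (∀ i → lookup k i ℕ.< N) → g k ∈ A) → ∑box r N g ∈ A
  ∑box-closed zero    N g∈A = g∈A [] λ ()
  ∑box-closed (suc r) N {g} g∈A = go N ℕ.≤-refl
    where
    go : ∀ M → M ℕ.≤ N → ∑< M (λ j → ∑box r N λ k → g (j ∷ k)) ∈ A
    go zero    _   = 0∈
    go (suc M) M<N = +-closed (go M (ℕ.<⇒≤ M<N))
      (∑box-closed r N λ k k<N → g∈A (M ∷ k) λ { zero → M<N ; (suc i) → k<N i })

  ∑box-≡ : ∀ r N {g h} → (∀ k → g k - h k ∈ A) → ∑box r N g - ∑box r N h ∈ A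
  ∑box-≡ r N {g} {h} g≡h = resp
    (trans (solve 2 (λ d h → d := d :+ h :- h) refl _ (∑box r N h)) (+-congʳ (trans (sym (∑box-+ r N _ _))
      (∑box-cong r N λ k _ → solve 2 (λ g h → g :- h :+ h := g) refl (g k) (h k)))))
    (∑box-closed r N λ k _ → g≡h k)

  ∑box-∈-resp : ∀ r N {g h} → (∀ k → g k - h k ∈ A) → ∑box r N h ∈ A → ∑box r N g ∈ A
  ∑box-∈-resp r N {g} {h} g≡h = IdealProperties.∈-resp-≡ R isIdeal (∑box-≡ r N g≡h)

-- Newton expansions with arbitrary nodes

module FallingFactorials {c ℓ} (R : CommutativeRing c ℓ) where
  open CommutativeRing R hiding (zero)
  open Ideals R
  open IntegerSolver R
  open FiniteSums R
  open SetoidReasoning setoid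
  open RawSemiringDefs (Semiring.rawSemiring semiring) using (product; _^_)

  differences-root : ∀ b {j k x} → x ≈ b j → j ℕ.< k → differences b k x ≈ 0#
  differences-root b {j} {suc k} x≈bⱼ j<1+k with ℕ.m<1+n⇒m<n∨m≡n j<1+k
  ... | inj₁ j<k    = trans (*-congʳ (differences-root b x≈bⱼ j<k)) (zeroˡ _)
  ... | inj₂ ≡.refl = trans (*-congˡ (trans (+-congʳ x≈bⱼ) (-‿inverseʳ (b k)))) (zeroʳ _)

  differences-∣ : ∀ b {j k} x → j ℕ.≤ k → ∃[ y ] differences b k x ≈ differences b j x * y
  differences-∣ b {j} x j≤k = go (ℕ.≤⇒≤′ j≤k)
    where
    go : ∀ {k} → j ℕ.≤′ k → ∃[ y ] differences b k x ≈ differences b j x * y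
    go ℕ.≤′-refl       = 1# , sym (*-identityʳ _)
    go (ℕ.≤′-step j≤k) with y , eq ← go j≤k = _ , trans (*-congʳ eq) (*-assoc _ _ _)

  -- (𝐱)_𝐤 at 𝐱 = x
  multi : ∀ {r} → (Fin r → ℕ → Carrier) → Vec ℕ r → Vector Carrier r → Carrier
  multi b k x = product (λ i → differences (b i) (lookup k i) (x i))

  -- A Newton form of degree below k with nodes b, stored with its leading coefficient outermost;
  -- only the values of F matter.
  Span : (ℕ → Carrier) → ℕ → (Carrier → Carrier) → Set (c ⊔ ℓ)
  Span b zero    F = Lift (c ⊔ ℓ) (∀ x → F x ≈ 0#)
  Span b (suc k) F = Σ[ G ∈ (Carrier → Carrier) ] ∃[ g ] (Span b k G × (∀ x → F x ≈ G x + g * differences b k x))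

  ∑<-Span : ∀ b k (g : ℕ → Carrier) → Span b k (λ x → ∑< k (λ j → g j * differences b j x))
  ∑<-Span b zero    g = lift λ _ → refl
  ∑<-Span b (suc k) g = _ , g k , ∑<-Span b k g , λ _ → refl

  -- Split x - c as (x - b k) + (b k - c): on the leading term, the first part raises the degree and
  -- the second only changes the coefficient.
  Span-*linear : ∀ b c k F → Span b k F → Span b (suc k) (λ x → F x * (x - c))
  Span-*linear b c zero    F (lift F≈0) =
    _ , 0# , lift (λ _ → refl) , λ x → trans (*-congʳ (F≈0 x))
      (solve 2 (λ x c → con (+ 0) :* (x :- c) := con (+ 0) :+ con (+ 0) :* con (+ 1)) refl x c)
  Span-*linear b c (suc k) F (G , g , spanG , F≈)
    with H , h , spanH , eq ← Span-*linear b c k G spanG =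
    _ , g , (H , h + g * (b k - c) , spanH , λ x → refl) , λ x → begin
      F x * (x - c)                          ≈⟨ *-congʳ (F≈ x) ⟩
      (G x + g * d x) * (x - c)              ≈⟨ solve 6 (λ G g d x c b → (G :+ g :* d) :* (x :- c) := G :* (x :- c) :+ g :* (b :- c) :* d :+ g :* (d :* (x :- b))) refl (G x) g (d x) x c (b k) ⟩
      G x * (x - c) + g * (b k - c) * d x + g * (d x * (x - b k))      ≈⟨ +-congʳ (+-congʳ (eq x)) ⟩
      H x + h * d x + g * (b k - c) * d x + g * (d x * (x - b k))      ≈⟨ +-congʳ (solve 4 (λ H h d k → H :+ h :* d :+ k :* d := H :+ (h :+ k) :* d) refl (H x) h (d x) (g * (b k - c))) ⟩
      H x + (h + g * (b k - c)) * d x + g * (d x * (x - b k))          ∎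
    where
    d : Carrier → Carrier
    d = differences b k

  -- Both products are monic of degree k, so their difference has lower degree; the induction uses x
  -- - c k = (x - b k) + (b k - c k).
  differences-monic : ∀ b c k → ∃[ G ] (Span b k G × (∀ x → differences c k x ≈ G x + differences b k x))
  differences-monic b c zero    = _ , lift (λ _ → refl) , λ x → sym (+-identityˡ 1#)
  differences-monic b c (suc k)
    with G , spanG , eq ← differences-monic b c k
    with H , h , spanH , eq′ ← Span-*linear b (c k) k G spanG =
    _ , (H , h + (b k - c k) , spanH , λ x → refl) , λ x → begin
      differences c k x * (x - c k)                 ≈⟨ *-congʳ (eq x) ⟩
      (G x + differences b k x) * (x - c k)         ≈⟨ solve 5 (λ G d x c b → (G :+ d) :* (x :- c) := G :* (x :- c) :+ (b :- c) :* d :+ d :* (x :- b)) refl (G x) _ x (c k) (b k) ⟩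
      G x * (x - c k) + (b k - c k) * differences b k x + differences b k x * (x - b k)
                                                    ≈⟨ +-congʳ (+-congʳ (eq′ x)) ⟩
      H x + h * differences b k x + (b k - c k) * differences b k x + differences b k x * (x - b k)
                                                    ≈⟨ +-congʳ (solve 4 (λ H h d k → H :+ h :* d :+ k :* d := H :+ (h :+ k) :* d) refl (H x) h _ (b k - c k)) ⟩
      H x + (h + (b k - c k)) * differences b k x + differences b k x * (x - b k) ∎

  -- x ^ m = Σ_j stirling b m j (x - b 0) ⋯ (x - b (j - 1))
  stirling : (ℕ → Carrier) → ℕ → ℕ → Carrier
  stirling b zero    zero    = 1#
  stirling b zero    (suc j) = 0#
  stirling b (suc m) zero    = b 0 * stirling b m 0
  stirling b (suc m) (suc j) = stirling b m j + b (suc j) * stirling b m (suc j)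

  stirling-0 : ∀ b {m j} → m ℕ.< j → stirling b m j ≈ 0#
  stirling-0 b {zero}  {suc j} _           = refl
  stirling-0 b {suc m} {suc j} (ℕ.s≤s m<j) = trans
    (+-cong (stirling-0 b m<j) (trans (*-congˡ (stirling-0 b (ℕ.m<n⇒m<1+n m<j))) (zeroʳ _)))
    (+-identityˡ 0#)

  private
    expansion : (ℕ → Carrier) → ℕ → Carrier → ℕ → Carrier
    expansion b m x N = ∑< N λ j → stirling b m j * differences b j x

    -- With d j for `differences b j x`, the identity x · d j = d (j + 1) + b j · d j matches the
    -- recursion of `stirling`; cutting the sum at N leaves the boundary term, which `stirling-0`
    -- removes when m < N.
    expansion-suc : ∀ b m x N →
      expansion b (suc m) x (suc N) ≈ x * expansion b m x N + b N * stirling b m N * differences b N x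
    expansion-suc b m x zero    = solve 3 (λ b s x → con (+ 0) :+ b :* s :* con (+ 1) := x :* con (+ 0) :+ b :* s :* con (+ 1)) refl (b 0) (stirling b m 0) x
    expansion-suc b m x (suc N) = trans (+-congʳ (expansion-suc b m x N))
      (solve 7 (λ x E β s d β′ s′ → x :* E :+ β :* s :* d :+ (s :+ β′ :* s′) :* (d :* (x :- β)) :=
                  x :* (E :+ s :* d) :+ β′ :* s′ :* (d :* (x :- β)))
        refl x (expansion b m x N) (b N) (stirling b m N) (differences b N x) (b (suc N)) (stirling b m (suc N)))

  ^-expansion : ∀ b m x {N} → m ℕ.< N → ∑< N (λ j → stirling b m j * differences b j x) ≈ x ^ m
  ^-expansion b zero    x {suc N} _ = trans (sym (∑<-extend {1} {suc N} _ (ℕ.s≤s ℕ.z≤n)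
    λ { (suc j) _ → zeroˡ _ })) (trans (+-identityˡ _) (*-identityˡ 1#))
  ^-expansion b (suc m) x {suc N} (ℕ.s≤s m<N) = begin
    expansion b (suc m) x (suc N)                                        ≈⟨ expansion-suc b m x N ⟩
    x * expansion b m x N + b N * stirling b m N * differences b N x     ≈⟨ +-cong (*-congˡ (^-expansion b m x m<N)) (*-congʳ (trans (*-congˡ (stirling-0 b m<N)) (zeroʳ _))) ⟩
    x * x ^ m + 0# * differences b N x                                   ≈⟨ trans (+-congˡ (zeroˡ _)) (+-identityʳ _) ⟩
    x * x ^ m                                                            ∎

-- Newton expansions vanishing modulo an ideal

module Vanishing {c ℓ} (R : CommutativeRing c ℓ) {A : Ideals.Subset R} (isIdeal : Ideals.IsIdeal R A) where
  open CommutativeRing R using (Carrier; _+_; _*_; _-_; 0#; 1#)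
  private module R = CommutativeRing R
  open Ideals R
  open IntegerSolver R
  open FiniteSums R
  open FallingFactorials R
  private
    R/A : CommutativeRing c (c ⊔ ℓ)
    R/A = quotientRing R A isIdeal
  open CommutativeRing R/A using (_≈_; refl; sym; trans; +-cong; +-congˡ; +-congʳ; *-cong; *-congˡ; *-congʳ;
    +-identityˡ; +-identityʳ; zeroˡ; zeroʳ; setoid; *-monoid)
  open SetoidReasoning setoid

  ↑ : ∀ {x y} → x R.≈ y → x ≈ y
  ↑ = IdealProperties.≈⇒≡ R isIdeal

  differences-cong : ∀ {b b′ x x′} → (∀ j → b j ≈ b′ j) → x ≈ x′ → ∀ k →
                     differences b k x ≈ differences b′ k x′
  differences-cong b≈ x≈ zero    = refl
  differences-cong {b} {b′} {x} {x′} b≈ x≈ (suc k) =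
    *-cong {differences b k x} {differences b′ k x′} {x - b k} {x′ - b′ k}
      (differences-cong {b} {b′} {x} {x′} b≈ x≈ k)
      (+-cong {x} {x′} x≈ (CommutativeRing.-‿cong R/A {b k} {b′ k} (b≈ k)))

  multi-cong : ∀ {r} {b b′ : Fin r → ℕ → Carrier} {x x′ : Vector Carrier r} →
               (∀ i j → b i j ≈ b′ i j) → (∀ i → x i ≈ x′ i) → ∀ k → multi b k x ≈ multi b′ k x′
  multi-cong {r} {b} {b′} {x} {x′} b≈ x≈ k =
    sum-cong-≋ {r} (λ i → differences-cong {b i} {b′ i} {x i} {x′ i} (b≈ i) (x≈ i) (lookup k i))
    where open import Algebra.Properties.Monoid.Sum *-monoid using (sum-cong-≋)

  module _ {b : ℕ → Carrier} {X : Subset} (b∈X : ∀ k → b k ∈ X)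
    (divides : ∀ k {x} → x ∈ X → ∃[ y ] differences b k x ≈ differences b k (b k) * y) where

    private
      *-vanishes : ∀ k g {x} → g * differences b k (b k) ≈ 0# → x ∈ X → g * differences b k x ≈ 0#
      *-vanishes k g {x} gδ≈0 x∈X with y , eq ← divides k x∈X = begin
        g * differences b k x                 ≈⟨ *-congˡ {g} eq ⟩
        g * (differences b k (b k) * y)       ≈⟨ ↑ (R.*-assoc g (differences b k (b k)) y) ⟨
        g * differences b k (b k) * y         ≈⟨ *-congʳ {y} {g * differences b k (b k)} {0#} gδ≈0 ⟩
        0# * y                                ≈⟨ zeroˡ y ⟩
        0#                                    ∎

    -- Once the leading term is zero at its own node b k, `divides` makes it zero on all of X, and
    -- the lower part is handled by induction.
    Span-vanishes : ∀ k {F} → Span b k F → (∀ j → j ℕ.< k → F (b j) ≈ 0#) → ∀ {x} → x ∈ X → F x ≈ 0#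
    -- The leading term has the roots b j for j < k, so G agrees with F there and vanishes on X by
    -- `Span-vanishes`. Evaluation at b k then isolates the leading term.
    Span-leading : ∀ k {F G} g → Span b k G → (∀ x → F x R.≈ G x + g * differences b k x) →
                   (∀ j → j ℕ.< suc k → F (b j) ≈ 0#) →
                   (∀ {x} → x ∈ X → G x ≈ 0#) × g * differences b k (b k) ≈ 0#

    Span-vanishes zero    (lift F≈0) _ {x} _ = ↑ (F≈0 x)
    Span-vanishes (suc k) {F} (G , g , spanG , F≈) F≈0 {x} x∈X
      with G≈0 , gδ≈0 ← Span-leading k {F} g spanG F≈ F≈0 = begin
      F x                            ≈⟨ ↑ (F≈ x) ⟩
      G x + g * differences b k x    ≈⟨ +-cong {G x} {0#} (G≈0 x∈X) (*-vanishes k g gδ≈0 x∈X) ⟩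
      0# + 0#                        ≈⟨ +-identityˡ 0# ⟩
      0#                             ∎

    Span-leading k {F} {G} g spanG F≈ F≈0 = G≈0 , (begin
      g * differences b k (b k)              ≈⟨ +-identityˡ _ ⟨
      0# + g * differences b k (b k)         ≈⟨ +-congʳ {g * differences b k (b k)} {G (b k)} {0#} (G≈0 (b∈X k)) ⟨
      G (b k) + g * differences b k (b k)    ≈⟨ ↑ (F≈ (b k)) ⟨
      F (b k)                                ≈⟨ F≈0 k ℕ.≤-refl ⟩
      0#                                     ∎)
      where
      G≈0 : ∀ {x} → x ∈ X → G x ≈ 0#
      G≈0 = Span-vanishes k spanG λ j j<k → begin
        G (b j)                              ≈⟨ ↑ (R.+-identityʳ _) ⟨
        G (b j) + 0#                         ≈⟨ ↑ (R.+-congˡ (R.trans (R.*-congˡ (differences-root b R.refl j<k)) (R.zeroʳ g))) ⟨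
        G (b j) + g * differences b k (b j)  ≈⟨ ↑ (F≈ (b j)) ⟨
        F (b j)                              ≈⟨ F≈0 j (ℕ.m<n⇒m<1+n j<k) ⟩
        0#                                   ∎

    coefficients-vanish : ∀ N (g : ℕ → Carrier) → (∀ {x} → x ∈ X → ∑< N (λ j → g j * differences b j x) ≈ 0#) →
                          ∀ j → j ℕ.< N → g j * differences b j (b j) ≈ 0#
    coefficients-vanish (suc N) g ∑≈0 j j<1+N
      with ∑′≈0 , gδ≈0 ← Span-leading N {λ x → ∑< (suc N) (λ j → g j * differences b j x)} (g N)
                           (∑<-Span b N g) (λ _ → R.refl) (λ j _ → ∑≈0 (b∈X j))
         | ℕ.m<1+n⇒m<n∨m≡n j<1+N
    ... | inj₁ j<N    = coefficients-vanish N g ∑′≈0 j j<N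
    ... | inj₂ ≡.refl = gδ≈0

    -- Among the monic polynomials of degree k, differences b k has the smallest
    -- ideal of values on X.
    monic-vanishes : ∀ c k → (∀ {x} → x ∈ X → differences c k x ≈ 0#) → differences b k (b k) ≈ 0#
    monic-vanishes c k c≈0 with G , spanG , eq ← differences-monic b c k = trans
      (↑ (R.sym (R.*-identityˡ (differences b k (b k)))))
      (proj₂ (Span-leading k {differences c k} 1# spanG
        (λ x → R.trans (eq x) (R.+-congˡ (R.sym (R.*-identityˡ _)))) (λ j _ → c≈0 (b∈X j))))

  -- With all variables but the first fixed in X, the sum is a Newton expansion in the first one,
  -- and its j-th coefficient times δ vanishes. This coefficient is itself an expansion in the
  -- remaining variables, so the induction applies to the coefficients `c (j ∷ k) * δ`.
  multi-coefficients-vanish : ∀ {r} {b : Fin r → ℕ → Carrier} {X : Fin r → Subset} →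
    (∀ i k → b i k ∈ X i) →
    (∀ i k {x} → x ∈ X i → ∃[ y ] differences (b i) k x ≈ differences (b i) k (b i k) * y) →
    ∀ N (c : Vec ℕ r → Carrier) → (∀ {x} → (∀ i → x i ∈ X i) → ∑box r N (λ k → c k * multi b k x) ≈ 0#) →
    ∀ k → (∀ i → lookup k i ℕ.< N) → c k * multi b k (λ i → b i (lookup k i)) ≈ 0#
  multi-coefficients-vanish {zero} b∈X divides N c ∑≈0 [] _ = ∑≈0 {λ ()} (λ ())
  multi-coefficients-vanish {suc r} {b} {X} b∈X divides N c ∑≈0 (j ∷ k) jk<N = begin
    c (j ∷ k) * (δ * Δ)    ≈⟨ ↑ (R.*-assoc (c (j ∷ k)) δ Δ) ⟨
    c (j ∷ k) * δ * Δ      ≈⟨ multi-coefficients-vanish (b∈X ∘ suc) (divides ∘ suc) N (λ k → c (j ∷ k) * δ) slice k (jk<N ∘ suc) ⟩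
    0#                     ∎
    where
    δ = differences (b zero) j (b zero j)
    Δ = multi (b ∘ suc) k (λ i → b (suc i) (lookup k i))

    slice : ∀ {x} → (∀ i → x i ∈ X (suc i)) → ∑box r N (λ k → c (j ∷ k) * δ * multi (b ∘ suc) k x) ≈ 0#
    slice {x} x∈X = trans
      (↑ (R.trans (∑box-cong r N λ k _ → xyz≈xzy (c (j ∷ k)) δ _) (∑box-*ʳ r N _ δ)))
      (coefficients-vanish (b∈X zero) (divides zero) N g
        (λ {x₀} x₀∈X → trans (↑ (∑<-cong N λ j _ → R.trans (R.sym (∑box-*ʳ r N _ _))
            (∑box-cong r N λ k _ → xzy≈xyz (c (j ∷ k)) (multi (b ∘ suc) k x) _)))
          (∑≈0 {x₀ Vector.∷ x} λ { zero → x₀∈X ; (suc i) → x∈X i }))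
        j (jk<N zero))
      where
      g : ℕ → Carrier
      g j = ∑box r N (λ k → c (j ∷ k) * multi (b ∘ suc) k x)
      xyz≈xzy : ∀ x y z → x * y * z R.≈ x * z * y
      xyz≈xzy = solve 3 (λ x y z → x :* y :* z := x :* z :* y) R.refl
      xzy≈xyz : ∀ x z y → x * z * y R.≈ x * (y * z)
      xzy≈xyz = solve 3 (λ x z y → x :* z :* y := x :* (y :* z)) R.refl

module PrincipalProducts {c ℓ} (R : CommutativeRing c ℓ) where
  open CommutativeRing R hiding (zero)
  open Ideals R
  open RawSemiringDefs (Semiring.rawSemiring semiring) using (product)
  open IntegerSolver R
  open IdealProperties R

  product-∣ : ∀ {n} {g h : Vector Carrier n} →
              (∀ i → ∃[ y ] g i ≈ h i * y) → ∃[ y ] product g ≈ product h * y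
  product-∣ {zero}  g∣h = 1# , sym (*-identityʳ 1#)
  product-∣ {suc n} {g} {h} g∣h with y , p ← g∣h zero | z , q ← product-∣ (g∣h ∘ suc) =
    y * z , trans (*-cong p q)
      (solve 4 (λ h y k z → h :* y :* (k :* z) := h :* k :* (y :* z)) refl (h zero) y _ z)

  ∏ᴵ-principal : ∀ {n} (Q : Vector Subset n) {g : Vector Carrier n} →
                 (∀ i {x} → x ∈ Q i → ∃[ y ] x ≈ g i * y) →
                 ∀ {x} → x ∈ ∏ᴵ Q → ∃[ y ] x ≈ product g * y
  ∏ᴵ-principal {zero}  Q Q⊆g {x} _ = x , sym (*-identityˡ x)
  ∏ᴵ-principal {suc n} Q {g} Q⊆g = ·-least (Q zero) (∏ᴵ (Q ∘ suc)) (principal-isIdeal (product g))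
    λ x∈ y∈ → let s , p = Q⊆g zero x∈ ; t , q = ∏ᴵ-principal (Q ∘ suc) (Q⊆g ∘ suc) y∈ in
      s * t , trans (*-cong p q)
        (solve 4 (λ h y k z → h :* y :* (k :* z) := h :* k :* (y :* z)) refl (g zero) s _ t)

-- Gluing over the primes of a semilocal ring

module Semilocal {c ℓ} (em : ExcludedMiddle (c ⊔ ℓ)) (R : CommutativeRing c ℓ)
  {n : ℕ} {P : Fin n → Ideals.Subset R} {e : Fin n → ℕ}
  (isChainPrime : ∀ l → IsChainPrime R (P l) (e l))
  (1∈-local : ∀ {C} → Ideals.IsIdeal R C →
    (∀ l → ∃[ s ] (s ∈ C × s ∉ P l)) → CommutativeRing.1# R ∈ C)
  (separate : ∀ l l′ → l′ ≢ l → ∃[ x ] (x ∈ P l′ × x ∉ P l))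
  where

  open CommutativeRing R hiding (zero)
  open Ideals R
  open RawSemiringDefs (Semiring.rawSemiring semiring) using (_^_)
  open IntegerSolver R
  open IdealProperties R
  open PrincipalProducts R
  open Zero R
  open FiniteSums R
  open FallingFactorials R

  private
    module Chain l = ChainPrime em R (isChainPrime l)
    isPrime : ∀ l → IsPrime (P l)
    isPrime l = IsChainPrime.isPrime (isChainPrime l)
    module Mod l = Vanishing R (Chain.L-isIdeal l)

  -- The ideal of all s with s y ∈ A meets the complement of every `P l`, so it contains 1.
  ∈-local : ∀ {A y} → IsIdeal A → (∀ l → y ∈ Loc (isPrime l) A) → y ∈ A
  ∈-local {A} {y} isA y∈ = IsIdeal.resp isA (*-identityˡ y)
    (1∈-local (colon-isIdeal isA y) λ l → let s , s∉ , sy∈ = y∈ l in s , sy∈ , s∉)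

  L⊆Loc : ∀ {A} → IsIdeal A → ∀ l → Chain.L l ⊆ Loc (isPrime l) A
  L⊆Loc {A} isA l = Loc-mono (isPrime l) {zeroIdeal} {A} λ (lift x≈0) →
    IsIdeal.resp isA (sym x≈0) (IsIdeal.0∈ isA)

  ∈-modulo-L : ∀ {A y} → IsIdeal A → (∀ l → ∃[ z ] (z ∈ A × y - z ∈ Chain.L l)) → y ∈ A
  ∈-modulo-L {A} {y} isA y≡ = ∈-local isA λ l → let z , z∈ , y-z∈ = y≡ l in
    ∈-resp-≡ {Loc (isPrime l) A} (Loc-isIdeal (isPrime l) isA) {y} {z} (L⊆Loc isA l y-z∈) (⊆Loc (isPrime l) isA z∈)

  module Factorials {X : Subset} {aₗ : Fin n → ℕ → Carrier}
    (isOrdering : ∀ l → IsOrdering (P l) X (aₗ l)) where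

    private module Ord l = IsOrdering (isOrdering l)

    d : Fin n → ℕ → Carrier
    d l k = differences (aₗ l) k (aₗ l k)

    seq : Fin n → ℕ → Subset
    seq l = orderingSequence (P l) (aₗ l)

    differences∈seq : ∀ l k {x} → x ∈ X → differences (aₗ l) k x ∈ seq l k
    differences∈seq l zero    x∈X = tt
    differences∈seq l (suc k) x∈X =
      Ord.minimal l (suc k) (ℕ.s≤s ℕ.z≤n) _ x∈X (Chain.self∈w l _)

    seq⇒∣ : ∀ l k {z} → z ∈ seq l k → ∃[ y ] z - d l k * y ∈ Chain.L l
    seq⇒∣ l zero    {z} _  = z , ≈⇒≡ (Chain.L-isIdeal l) (sym (*-identityˡ z))
    seq⇒∣ l (suc k)     z∈ = Chain.w⇒∣ l z∈

    ∃^∈seq : ∀ l k {x} → ¬ d l k ≈ 0# → x ∈ P l → ∃[ m ] x ^ m ∈ seq l k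
    ∃^∈seq l zero    d≉0 x∈P = 0 , tt
    ∃^∈seq l (suc k) d≉0 x∈P = Chain.∃^∈w l d≉0 x∈P

    -- Minimality places every value on X in `w (P l) 0#`, the zero ideal of R, so the values vanish
    -- in R and not merely at `P l`.
    differences≈0 : ∀ l k {x} → d l k ≈ 0# → x ∈ X → differences (aₗ l) k x ≈ 0#
    differences≈0 l zero    d≈0 x∈X = d≈0
    differences≈0 l (suc k) d≈0 x∈X with differences∈seq l (suc k) x∈X
    ... | inj₁ (_ , p)   = p
    ... | inj₂ (d≉0 , _) = contradiction d≈0 d≉0

    differences-∣-local : ∀ l k {x} → x ∈ X →
                          ∃[ y ] differences (aₗ l) k x - d l k * y ∈ Chain.L l
    differences-∣-local l k x∈X = seq⇒∣ l k (differences∈seq l k x∈X)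

    -- Vanishing spreads from one prime to the others: `differences (aₗ l) k` is then a monic
    -- polynomial of degree k that is zero on X, and `monic-vanishes` compares it with the ordering
    -- at `l′`.
    d-vanishes : ∀ l l′ k → d l k ≈ 0# → d l′ k - 0# ∈ Chain.L l′
    d-vanishes l l′ k d≈0 = Mod.monic-vanishes l′ (Ord.b∈X l′) (differences-∣-local l′)
      (aₗ l) k (λ x∈X → Mod.↑ l′ (differences≈0 l k d≈0 x∈X))

    module _ {a : ℕ → Carrier} (a≡aₗ : ∀ j l → a j - aₗ l j ∈ P l ^ᴵ e l) where

      δ : ℕ → Carrier
      δ k = differences a k (a k)

      v : ℕ → Subset
      v k = ∏ᴵ (λ l → seq l k)

      private
        module L l = CommutativeRing (quotientRing R (Chain.L l) (Chain.L-isIdeal l))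

      a≡ : ∀ l j → a j - aₗ l j ∈ Chain.L l
      a≡ l j = Chain.Pᵉ⊆L l (a≡aₗ j l)

      differences≡ : ∀ l k x → differences a k x - differences (aₗ l) k x ∈ Chain.L l
      differences≡ l k x = Mod.differences-cong l (a≡ l) (L.refl l {x}) k

      δ≡d : ∀ l k → δ k - d l k ∈ Chain.L l
      δ≡d l k = Mod.differences-cong l (a≡ l) (a≡ l k) k

      ∣-local⇒∣ : ∀ k {z} → (∀ l → ∃[ y ] z - d l k * y ∈ Chain.L l) → ∃[ y ] z ≈ δ k * y
      ∣-local⇒∣ k {z} div = ∈-modulo-L (principal-isIdeal (δ k)) λ l → let y , p = div l in
        δ k * y , (y , refl) , L.trans l {z} {d l k * y} {δ k * y} p
          (L.*-congʳ l {y} {d l k} {δ k} (L.sym l {δ k} {d l k} (δ≡d l k)))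

      differences-∣-δ : ∀ k {x} → x ∈ X → ∃[ y ] differences a k x ≈ δ k * y
      differences-∣-δ k {x} x∈X = ∣-local⇒∣ k λ l → let y , p = differences-∣-local l k x∈X in
        y , L.trans l {differences a k x} {differences (aₗ l) k x} {d l k * y} (differences≡ l k x) p

      -- At `P l` the l-th factor suffices: its elements are multiples of `d l k` modulo `L`, and
      -- these multiples form an ideal, which therefore contains the whole product.
      v⇒∣ : ∀ k {z} → z ∈ v k → ∃[ y ] z ≈ δ k * y
      v⇒∣ k z∈ = ∣-local⇒∣ k λ l →
        ∏ᴵ-⊆ (λ l → seq l k) {λ z → ∃[ y ] z - d l k * y ∈ Chain.L l} (multiples-isIdeal l (d l k)) l (seq⇒∣ l k) z∈
        where
        multiples-isIdeal : ∀ l d → IsIdeal (λ z → ∃[ y ] z - d * y ∈ Chain.L l)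
        multiples-isIdeal l d = record
          { resp     = λ x≈y (s , p) → s , I.resp (+-congʳ x≈y) p
          ; 0∈       = 0# , I.resp (solve 1 (λ d → con (+ 0) := con (+ 0) :- d :* con (+ 0)) refl d) I.0∈
          ; +-closed = λ {x} {y} (s , p) (t , q) → s + t , I.resp
              (solve 5 (λ x y d s t → (x :- d :* s) :+ (y :- d :* t) := x :+ y :- d :* (s :+ t)) refl x y d s t)
              (I.+-closed p q)
          ; *-closed = λ x {y} (s , p) → x * s , I.resp
              (solve 4 (λ x y d s → x :* (y :- d :* s) := x :* y :- d :* (x :* s)) refl x y d s)
              (I.*-closed x p)
          }
          where module I = IsIdeal (Chain.L-isIdeal l)

      d≡0⇒δ≈0 : ∀ k → (∀ l → d l k - 0# ∈ Chain.L l) → δ k ≈ 0#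
      d≡0⇒δ≈0 k d≡0 = lower (∈-modulo-L zeroIdeal-isIdeal λ l → 0# , lift refl ,
        L.trans l {δ k} {d l k} {0#} (δ≡d l k) (d≡0 l))

      -- If the term with index t repeats an earlier one, then `d l t` is 0, so the product of the
      -- first t differences vanishes on X; it divides the product of the first k.
      repetition⇒δ≈0 : ∀ k → (∀ l → ∃[ s ] ∃[ t ] (s ℕ.< t × t ℕ.≤ k × aₗ l t ≈ aₗ l s)) → δ k ≈ 0#
      repetition⇒δ≈0 k repetition = d≡0⇒δ≈0 k λ l →
        let s , t , s<t , t≤k , aₜ≈aₛ = repetition l
            y , d≈ = differences-∣ (aₗ l) (aₗ l k) t≤k
        in Mod.↑ l (trans d≈ (trans (*-congʳ
             (differences≈0 l t (differences-root (aₗ l) aₜ≈aₛ s<t) (Ord.b∈X l k))) (zeroˡ y)))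

      -- The cases come from the convention for `w` at 0. If some `d l k` is 0, then v k may be the
      -- zero ideal, and `d-vanishes` gives δ k = 0. Otherwise every factor contains a power of each
      -- element of its prime, so at `P l` the other factors become the unit ideal.
      δ∈v : ∀ k → δ k ∈ v k
      δ∈v k with em {∃[ l ] Lift c (d l k ≈ 0#)}
      ... | yes (l₀ , lift d≈0) = v.resp (sym (d≡0⇒δ≈0 k λ l → d-vanishes l₀ l k d≈0)) v.0∈
        where module v = IsIdeal (∏ᴵ-isIdeal (λ l → seq l k))
      ... | no none = ∈-local isV local
        where
        isV : IsIdeal (v k)
        isV = ∏ᴵ-isIdeal (λ l → seq l k)
        local : ∀ l → δ k ∈ Loc (isPrime l) (v k)
        local l with t , t∉ , t∈ ← ∏ᴵ-cofactor (isPrime l) (λ l → seq l k) l (λ l′ l′≢l →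
                  let x , x∈ , x∉ = separate l l′ l′≢l
                      m , xᵐ∈ = ∃^∈seq l′ k (λ d≈0 → none (l′ , lift d≈0)) x∈
                  in x ^ m , xᵐ∈ , ^-∉ (isPrime l) m x∉) =
          ∈-resp-≡ {Loc (isPrime l) (v k)} (Loc-isIdeal (isPrime l) isV) {δ k} {d l k} (L⊆Loc isV l (δ≡d l k))
            (t , t∉ , t∈ (differences∈seq l k (Ord.b∈X l k)))

      v⊆⇔δ∈ : ∀ k {J} → IsIdeal J → (v k ⊆ J → δ k ∈ J) × (δ k ∈ J → v k ⊆ J)
      v⊆⇔δ∈ k isJ = (λ v⊆J → v⊆J (δ∈v k)) , λ δ∈J z∈ → let y , z≈ = v⇒∣ k z∈ in
        IsIdeal.resp isJ (sym z≈) (*-closedʳ isJ y δ∈J)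

  module Multivariate {r : ℕ} {X : Fin r → Subset} {aₗ : Fin n → Fin r → ℕ → Carrier}
    (isOrdering : ∀ l i → IsOrdering (P l) (X i) (aₗ l i))
    {a : Fin r → ℕ → Carrier} (a≡aₗ : ∀ i j l → a i j - aₗ l i j ∈ P l ^ᴵ e l)
    {J : Subset} (isJ : IsIdeal J) where

    private module F i = Factorials (λ l → isOrdering l i)

    Δ : Vec ℕ r → Carrier
    Δ k = multi a k (λ i → a i (lookup k i))

    vAt : Vec ℕ r → Subset
    vAt k = ∏ᴵ (λ i → F.v i (a≡aₗ i) (lookup k i))

    ann⇒ : ∀ k {b} → (∀ x → x ∈ vAt k → b * x ∈ J) → b * Δ k ∈ J
    ann⇒ k ann = ann (Δ k) (∏ᴵ-intro (λ i → F.v i (a≡aₗ i) (lookup k i)) (λ i → F.δ∈v i (a≡aₗ i) (lookup k i)))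

    vAt⇒∣ : ∀ k {x} → x ∈ vAt k → ∃[ y ] x ≈ Δ k * y
    vAt⇒∣ k {x} x∈ = ∏ᴵ-principal (λ i → F.v i (a≡aₗ i) (lookup k i)) {λ i → F.δ i (a≡aₗ i) (lookup k i)}
      (λ i {x} x∈ → F.v⇒∣ i (a≡aₗ i) (lookup k i) {x} x∈) {x} x∈

    ⇒ann : ∀ k {b} → b * Δ k ∈ J → ∀ x → x ∈ vAt k → b * x ∈ J
    ⇒ann k {b} bΔ∈J x x∈ = let y , x≈ = vAt⇒∣ k {x} x∈ in
      IsIdeal.resp isJ (trans (*-assoc b (Δ k) y) (*-congˡ (sym x≈))) (*-closedʳ isJ y bΔ∈J)

    multi-∣ : ∀ k {x} → (∀ i → x i ∈ X i) → ∃[ y ] multi a k x ≈ Δ k * y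
    multi-∣ k {x} x∈X = product-∣ {r} {λ i → differences (a i) (lookup k i) (x i)} {λ i → F.δ i (a≡aₗ i) (lookup k i)}
      (λ i → F.differences-∣-δ i (a≡aₗ i) (lookup k i) (x∈X i))

    values∈ : ∀ N (c : Vec ℕ r → Carrier) → (∀ k → (∀ i → lookup k i ℕ.< N) → c k * Δ k ∈ J) →
              ∀ {x} → (∀ i → x i ∈ X i) → ∑box r N (λ k → c k * multi a k x) ∈ J
    values∈ N c cΔ∈J x∈X = IdealSums.∑box-closed R isJ r N λ k k<N →
      let y , eq = multi-∣ k x∈X in
      IsIdeal.resp isJ (trans (*-assoc (c k) (Δ k) y) (*-congˡ (sym eq))) (*-closedʳ isJ y (cΔ∈J k k<N))

    -- The hypothesis concerns arguments in `X i`, and `a i j` may lie outside. Modulo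
    -- `Loc (isPrime l) J` it can be replaced by `aₗ l i j`, which is in `X i`.
    coefficients∈ : ∀ N (c : Vec ℕ r → Carrier) → (∀ {x} → (∀ i → x i ∈ X i) → ∑box r N (λ k → c k * multi a k x) ∈ J) →
                    ∀ k → (∀ i → lookup k i ℕ.< N) → c k * Δ k ∈ J
    coefficients∈ N c values∈J k k<N = ∈-local isJ local
      where
      local : ∀ l → c k * Δ k ∈ Loc (isPrime l) J
      local l = ≡0⇒∈ isA (A.trans {c k * Δ k} {c k * Δₗ} {0#}
          (A.*-congˡ {c k} {Δ k} {Δₗ} (M.multi-cong a≡ (λ i → a≡ i (lookup k i)) k))
          (M.multi-coefficients-vanish (λ i → IsOrdering.b∈X (isOrdering l i))
            (λ i k x∈ → let y , p = F.differences-∣-local i l k x∈ in y , L⊆A p)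
            N c (λ {x} x∈X → ∈⇒≡0 isA (∑∈A x x∈X)) k k<N))
        where
        A : Subset
        A = Loc (isPrime l) J
        isA : IsIdeal A
        isA = Loc-isIdeal (isPrime l) isJ
        module A = CommutativeRing (quotientRing R A isA)
        module M = Vanishing R isA
        Δₗ = multi (aₗ l) k (λ i → aₗ l i (lookup k i))

        L⊆A : Chain.L l ⊆ A
        L⊆A = L⊆Loc isJ l

        a≡ : ∀ i j → a i j - aₗ l i j ∈ A
        a≡ i j = L⊆A (Chain.Pᵉ⊆L l (a≡aₗ i j l))

        ∑∈A : ∀ x → (∀ i → x i ∈ X i) → ∑box r N (λ k → c k * multi (aₗ l) k x) ∈ A
        ∑∈A x x∈X = IdealSums.∑box-∈-resp R isA r N
          (λ k → A.*-congˡ {c k} {multi (aₗ l) k x} {multi a k x} (A.sym {multi a k x} {multi (aₗ l) k x}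
            (M.multi-cong a≡ (λ i → A.refl {x i}) k)))
          (⊆Loc (isPrime l) isJ (values∈J x∈X))

-- Evaluation of formal polynomials and change of basis

module Evaluation {c ℓ} (R : CommutativeRing c ℓ) where
  open CommutativeRing R hiding (zero)
  open IntegerSolver R
  open SetoidReasoning setoid
  open RawSemiringDefs (Semiring.rawSemiring semiring) using (product; _^_)
  open import Algebra.Properties.Semiring.Exp semiring using (^-homo-*; ^-congʳ)
  open CommutativeMonoidSum *-commutativeMonoid using ()
    renaming (∑-distrib-+ to product-*; sum-cong-≋ to product-cong; sum-replicate-zero to product-1)
  open FiniteSums R
  open FallingFactorials R
  open Ideals R using (differences)

  monomial : ∀ {r} → Vec ℕ r → Vector Carrier r → Carrier
  monomial m x = product (λ i → x i ^ lookup m i)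

  monomial-replicate-0 : ∀ r x → monomial (Vec.replicate r 0) x ≈ 1#
  monomial-replicate-0 r x = trans
    (product-cong {r} λ i → ^-congʳ (x i) (Vec.lookup-replicate i 0)) (product-1 r)

  monomial-var : ∀ {r} (i : Fin r) x → monomial (Vec.replicate r 0 Vec.[ i ]≔ 1) x ≈ x i
  monomial-var {suc r} zero    x = trans
    (*-cong (*-identityʳ (x zero)) (monomial-replicate-0 r (x ∘ suc))) (*-identityʳ (x zero))
  monomial-var {suc r} (suc i) x = trans (*-identityˡ _) (monomial-var i (x ∘ suc))

  monomial-+ : ∀ {r} m m′ (x : Vector Carrier r) →
               monomial (Vec.zipWith ℕ._+_ m m′) x ≈ monomial m x * monomial m′ x
  monomial-+ {r} m m′ x = trans
    (product-cong {r} λ i → trans (^-congʳ (x i) (Vec.lookup-zipWith ℕ._+_ i m m′))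
                                  (^-homo-* (x i) (lookup m i) (lookup m′ i)))
    (product-* {r} _ _)

  module _ {r : ℕ} (x : Vector Carrier r) where
    open Polynomials R r

    private
      term : Carrier × Vec ℕ r → Carrier
      term (a , m) = a * monomial m x

    eval-+ : ∀ F G → eval (F +ᴾ G) x ≈ eval F x + eval G x
    eval-+ = ∑ˡ-++ term

    eval-constant : ∀ a → eval (constant a) x ≈ a
    eval-constant a = trans (+-identityʳ _) (trans (*-congˡ (monomial-replicate-0 r x)) (*-identityʳ a))

    eval-var : ∀ i → eval (var i) x ≈ x i
    eval-var i = trans (+-identityʳ _) (trans (*-identityˡ _) (monomial-var i x))

    eval-* : ∀ F G → eval (F *ᴾ G) x ≈ eval F x * eval G x
    eval-* []            G = sym (zeroˡ _)
    eval-* ((a , m) ∷ F) G = begin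
      eval (List.map mul G ++ (F *ᴾ G)) x                   ≈⟨ eval-+ (List.map mul G) (F *ᴾ G) ⟩
      eval (List.map mul G) x + eval (F *ᴾ G) x             ≈⟨ +-cong (eval-mul G) (eval-* F G) ⟩
      a * monomial m x * eval G x + eval F x * eval G x     ≈⟨ distribʳ _ _ _ ⟨
      (a * monomial m x + eval F x) * eval G x              ∎
      where
      mul : Carrier × Vec ℕ r → Carrier × Vec ℕ r
      mul (b , m′) = a * b , Vec.zipWith ℕ._+_ m m′
      eval-mul : ∀ G → eval (List.map mul G) x ≈ a * monomial m x * eval G x
      eval-mul []             = sym (zeroʳ _)
      eval-mul ((b , m′) ∷ G) = trans
        (+-cong (*-congˡ (monomial-+ m m′ x)) (eval-mul G))
        (solve 5 (λ a b p q g → a :* b :* (p :* q) :+ a :* p :* g := a :* p :* (b :* q :+ g))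
          refl a b (monomial m x) (monomial m′ x) _)

    eval-product : ∀ {n} (Fs : Vector Polynomial n) →
                   eval (Vector.foldr _*ᴾ_ (constant 1#) Fs) x ≈ product (λ i → eval (Fs i) x)
    eval-product {zero}  Fs = eval-constant 1#
    eval-product {suc n} Fs = trans (eval-* (Fs zero) _) (*-congˡ (eval-product (Fs ∘ suc)))

    eval-concatMap : ∀ {a} {A : Set a} (F : A → Polynomial) ks →
                     eval (List.concatMap F ks) x ≈ ∑ˡ (λ k → eval (F k) x) ks
    eval-concatMap F []       = refl
    eval-concatMap F (k ∷ ks) = trans (eval-+ (F k) _) (+-congˡ (eval-concatMap F ks))

  module _ {r : ℕ} (b : Fin r → ℕ → Carrier) where
    open Polynomials R r

    -- A monomial is a product of powers of single variables, so its coordinates with respect to the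
    -- `(𝐱)_𝐤` are products of one-variable coordinates.
    monomialCoefficient : Vec ℕ r → Vec ℕ r → Carrier
    monomialCoefficient m k = product (λ i → stirling (b i) (lookup m i) (lookup k i))

    coefficient : Polynomial → Vec ℕ r → Carrier
    coefficient []            k = 0#
    coefficient ((a , m) ∷ F) k = a * monomialCoefficient m k + coefficient F k

    -- The total degree bounds the exponent of each variable; the successor is due to the strict
    -- bound in `box`.
    degreeBound : Polynomial → ℕ
    degreeBound []            = 0
    degreeBound ((a , m) ∷ F) = suc (Vec.sum m) ℕ.⊔ degreeBound F

    private
      lookup≤sum : ∀ {r} (m : Vec ℕ r) i → lookup m i ℕ.≤ Vec.sum m
      lookup≤sum (m ∷ ms) zero    = ℕ.m≤m+n m _
      lookup≤sum (m ∷ ms) (suc i) = ℕ.≤-trans (lookup≤sum ms i) (ℕ.m≤n+m _ m)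

      product-0 : ∀ {n} {g : Vector Carrier n} i → g i ≈ 0# → product g ≈ 0#
      product-0 zero    gᵢ≈0 = trans (*-congʳ gᵢ≈0) (zeroˡ _)
      product-0 (suc i) gᵢ≈0 = trans (*-congˡ (product-0 i gᵢ≈0)) (zeroʳ _)

    coefficient-0 : ∀ F {N} k → degreeBound F ℕ.≤ N → ¬ (∀ i → lookup k i ℕ.< N) → coefficient F k ≈ 0#
    coefficient-0 []            k _   k≮N = refl
    coefficient-0 ((a , m) ∷ F) {N} k d≤N k≮N
      with i , kᵢ≮N ← Fin.¬∀⟶∃¬ r (λ i → lookup k i ℕ.< N) (λ i → lookup k i ℕ.<? N) k≮N = trans
        (+-cong (trans (*-congˡ (product-0 i (stirling-0 (b i) m<k))) (zeroʳ a))
                (coefficient-0 F k (ℕ.≤-trans (ℕ.m≤n⊔m (suc (Vec.sum m)) (degreeBound F)) d≤N) k≮N))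
        (+-identityˡ 0#)
      where
      m<k : lookup m i ℕ.< lookup k i
      m<k = ℕ.≤-trans (ℕ.s≤s (lookup≤sum m i))
        (ℕ.≤-trans (ℕ.m≤m⊔n (suc (Vec.sum m)) (degreeBound F)) (ℕ.≤-trans d≤N (ℕ.≮⇒≥ kᵢ≮N)))

    private
      monomial-expansion : ∀ m x {N} → Vec.sum m ℕ.< N →
        ∑box r N (λ k → monomialCoefficient m k * multi b k x) ≈ monomial m x
      monomial-expansion m x {N} m<N = begin
        ∑box r N (λ k → monomialCoefficient m k * multi b k x)
          ≈⟨ ∑box-cong r N (λ k _ → sym (product-* {r} _ _)) ⟩
        ∑box r N (λ k → product (λ i → s i (lookup k i) * differences (b i) (lookup k i) (x i)))
          ≈⟨ ∑box-product r N (λ i j → s i j * differences (b i) j (x i)) ⟩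
        product (λ i → ∑< N (λ j → s i j * differences (b i) j (x i)))
          ≈⟨ product-cong {r} (λ i → ^-expansion (b i) (lookup m i) (x i) (ℕ.≤-<-trans (lookup≤sum m i) m<N)) ⟩
        monomial m x ∎
        where
        s : Fin r → ℕ → Carrier
        s i = stirling (b i) (lookup m i)

    expansion : ∀ F x {N} → degreeBound F ℕ.≤ N →
                ∑box r N (λ k → coefficient F k * multi b k x) ≈ eval F x
    expansion []            x {N} _   = ∑box-0 r N λ k → zeroˡ _
    expansion ((a , m) ∷ F) x {N} d≤N = begin
      ∑box r N (λ k → (a * C k + coefficient F k) * M k)
        ≈⟨ ∑box-cong r N (λ k _ → solve 4 (λ a c f m → (a :* c :+ f) :* m := c :* m :* a :+ f :* m) refl a (C k) (coefficient F k) (M k)) ⟩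
      ∑box r N (λ k → C k * M k * a + coefficient F k * M k)
        ≈⟨ ∑box-+ r N _ _ ⟩
      ∑box r N (λ k → C k * M k * a) + ∑box r N (λ k → coefficient F k * M k)
        ≈⟨ +-cong (∑box-*ʳ r N _ a) (expansion F x (ℕ.≤-trans (ℕ.m≤n⊔m (suc (Vec.sum m)) (degreeBound F)) d≤N)) ⟩
      ∑box r N (λ k → C k * M k) * a + eval F x
        ≈⟨ +-congʳ (*-congʳ (monomial-expansion m x (ℕ.≤-trans (ℕ.m≤m⊔n (suc (Vec.sum m)) (degreeBound F)) d≤N))) ⟩
      monomial m x * a + eval F x
        ≈⟨ +-congʳ (*-comm _ a) ⟩
      a * monomial m x + eval F x ∎
      where
      C M : Vec ℕ r → Carrier
      C = monomialCoefficient m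
      M k = multi b k x

-- Ideals of D above K as ideals of R

module QuotientIdeals {c ℓ} (D : CommutativeRing c ℓ) {K : Ideals.Subset D}
  (isK : Ideals.IsIdeal D K) where

  private
    module D = CommutativeRing D
    module ID = Ideals D
    R : CommutativeRing c (c ⊔ ℓ)
    R = quotientRing D K isK
    module R = CommutativeRing R
    module IR = Ideals R
    module PD = IdealProperties D
    module PR = IdealProperties R

  ↑ : ∀ {x y} → x D.≈ y → x R.≈ y
  ↑ = PD.≈⇒≡ isK

  image-isIdeal : ∀ {A} → ID.IsIdeal A → K ⊆ A → IR.IsIdeal A
  image-isIdeal isA K⊆A = record
    { resp     = λ {x} {y} x-y∈K x∈A → PD.∈-resp-≡ isA (K⊆A (R.sym {x} {y} x-y∈K)) x∈A
    ; 0∈       = ID.IsIdeal.0∈ isA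
    ; +-closed = ID.IsIdeal.+-closed isA
    ; *-closed = ID.IsIdeal.*-closed isA
    }

  preimage-isIdeal : ∀ {A} → IR.IsIdeal A → ID.IsIdeal A
  preimage-isIdeal isA = record
    { resp     = λ x≈y → IR.IsIdeal.resp isA (↑ x≈y)
    ; 0∈       = IR.IsIdeal.0∈ isA
    ; +-closed = IR.IsIdeal.+-closed isA
    ; *-closed = IR.IsIdeal.*-closed isA
    }

  K⊆ : ∀ {A} → IR.IsIdeal A → K ⊆ A
  K⊆ isA {x} x∈K = IR.IsIdeal.resp isA {D.0#} {x}
    (R.sym {x} {D.0#} (PD.∈⇒≡0 isK x∈K)) (IR.IsIdeal.0∈ isA)

  -- Products formed in R compare sums modulo K, so the power in R is the power in D plus K. The
  -- induction replaces A, for each x ∈ P, by the ideal of all y with y x ∈ A.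
  image-^ᴵ : ∀ {P} m {A} → ID.IsIdeal A → K ⊆ A → P ID.^ᴵ m ⊆ A → P IR.^ᴵ m ⊆ A
  image-^ᴵ     zero    isA K⊆A U⊆A x∈ = U⊆A tt
  image-^ᴵ {P} (suc m) isA K⊆A Pᵐ⊆A   = PR.·-least P (P IR.^ᴵ m) (image-isIdeal isA K⊆A)
    λ {x} {y} x∈P y∈ → ID.IsIdeal.resp isA (D.*-comm y x)
      (image-^ᴵ m (PD.colon-isIdeal isA x) (λ z∈K → PD.*-closedʳ isA x (K⊆A z∈K))
        (λ {z} z∈ → ID.IsIdeal.resp isA (D.*-comm x z) (Pᵐ⊆A (PD.·-intro P (P ID.^ᴵ m) x∈P z∈))) y∈)

-- The quotient R = D / K and the uniqueness and existence of coefficients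

module MainTheorem {c ℓ} (em : ExcludedMiddle (c ⊔ ℓ)) (S : Setting c ℓ) (Q : FixedSequences S) where
  open Setting S
  open FixedSequences Q
  open Notation S Q

  private
    module D = CommutativeRing D
    module ID = Ideals D
    module R = CommutativeRing R
    module IR = Ideals R
    module PD = IdealProperties D
    module CD = Classical em D
  open QuotientIdeals D K-isIdeal
  open RawSemiringDefs (Semiring.rawSemiring D.semiring) using (product; _^_)
  open R using (Carrier)

  private
    -- Since K lies in every `P l`, this one element can serve as the `a` of `Uniformizer` at all
    -- primes.
    K-nonzero : ∃[ x ] (x ∈ K × ¬ x D.≈ D.0#)
    K-nonzero = product y D.* z
      , ((λ i → PD.*-closedʳ (I-isIdeal i) z (PD.product-closed (I-isIdeal i) i (proj₁ (proj₂ (pick i)))))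
        , ID.IsIdeal.*-closed J-isIdeal (product y) (proj₁ (proj₂ pickJ)))
      , *-nonzero (product-nonzero (λ i → proj₂ (proj₂ (pick i)))) (proj₂ (proj₂ pickJ))
      where
      pick : ∀ i → ∃[ x ] (x ∈ I i × ¬ x D.≈ D.0#)
      pick i = CD.nonzero-element (I≢0 i)
      pickJ = CD.nonzero-element J≢0
      y : Vector D.Carrier r
      y i = proj₁ (pick i)
      z = proj₁ pickJ
      domain = ID.IsDedekindDomain.isIntegralDomain isDedekind
      *-nonzero : ∀ {x y} → ¬ x D.≈ D.0# → ¬ y D.≈ D.0# → ¬ x D.* y D.≈ D.0#
      *-nonzero {x} {y} x≉0 y≉0 xy≈0 = [ x≉0 , y≉0 ]′ (proj₂ domain x y xy≈0)
      product-nonzero : ∀ {n} {g : Vector D.Carrier n} → (∀ i → ¬ g i D.≈ D.0#) → ¬ product g D.≈ D.0#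
      product-nonzero {zero}  g≉0 = proj₁ domain
      product-nonzero {suc n} g≉0 = *-nonzero (g≉0 zero) (product-nonzero (g≉0 ∘ suc))

    P-isIdeal : ∀ l → ID.IsIdeal (P l)
    P-isIdeal l = ID.IsPrime.isIdeal (P-isPrime l)

    Pᵉ : Vector Subset n
    Pᵉ l = P l ID.^ᴵ e l

    ∏Pᵉ⊆K : ID.∏ᴵ Pᵉ ⊆ K
    ∏Pᵉ⊆K = proj₂ K≐∏P^e

    K⊆P : ∀ l → K ⊆ P l
    K⊆P l x∈K = PD.^ᴵ⊆ (P-isIdeal l) (e≥1 l)
      (PD.∏ᴵ-⊆ Pᵉ (PD.^ᴵ-isIdeal (e l)) l (λ x∈ → x∈) (proj₁ K≐∏P^e x∈K))

    module U l = Uniformizer em D isDedekind (P l) (P-isPrime l)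
      (proj₁ K-nonzero) (K⊆P l (proj₁ (proj₂ K-nonzero))) (proj₂ (proj₂ K-nonzero))

    -- Nonzero primes of D are maximal, so an inclusion between two of them is an equality.
    separate : ∀ l l′ → l′ ≢ l → ∃[ x ] (x ∈ P l′ × x ∉ P l)
    separate l l′ l′≢l = CD.⊈⇒∃ {P l′} {P l} λ P⊆P → case-maximal (ID.IsMaximal.maximal
      (ID.IsDedekindDomain.dimension≤1 isDedekind (P l′) (P-isPrime l′)
        (λ P≡0 → proj₂ (proj₂ K-nonzero) (P≡0 _ (K⊆P l′ (proj₁ (proj₂ K-nonzero))))))
      (P l) (P-isIdeal l) P⊆P)
      where
      case-maximal : ¬ (P l ≐ P l′ ⊎ ID.IsWhole (P l))
      case-maximal (inj₁ same)  = P-distinct l l′ (l′≢l ∘ ≡.sym) same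
      case-maximal (inj₂ whole) = ID.IsPrime.proper (P-isPrime l) whole

    -- The source of `t` in `IsChainPrime`: multiplied by t, the l-th prime power falls into the
    -- full product, which is K and hence 0 in R.
    cofactor : ∀ l → ∃[ t ] (t ∉ P l × (∀ {x} → x ∈ Pᵉ l → t D.* x ∈ ID.∏ᴵ Pᵉ))
    cofactor l = PD.∏ᴵ-cofactor (P-isPrime l) Pᵉ l λ l′ l′≢l →
      let x , x∈ , x∉ = separate l l′ l′≢l
      in x ^ e l′ , PD.^-∈-^ᴵ (e l′) x∈ , PD.^-∉ (P-isPrime l) (e l′) x∉

    cofactor-annihilates : ∀ l {x} → x ∈ P l IR.^ᴵ e l → x D.* proj₁ (cofactor l) ∈ K
    cofactor-annihilates l = image-^ᴵ (e l) (PD.colon-isIdeal K-isIdeal t) (PD.*-closedʳ K-isIdeal t)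
      (λ {y} y∈ → ID.IsIdeal.resp K-isIdeal (D.*-comm t y) (∏Pᵉ⊆K (proj₂ (proj₂ (cofactor l)) y∈)))
      where t = proj₁ (cofactor l)

    isChainPrime : ∀ l → IsChainPrime R (P l) (e l)
    isChainPrime l = record
      { isPrime = record
        { isIdeal = image-isIdeal (P-isIdeal l) (K⊆P l)
        ; proper  = ID.IsPrime.proper (P-isPrime l)
        ; split   = ID.IsPrime.split (P-isPrime l)
        }
      ; ∉⇒unit = λ s∉P → let σ , π , π∈ , eq = U.∉⇒unit l s∉P in σ , π , π∈ , ↑ eq
      ; q = q ; u = u ; t = t
      ; q∈P = proj₁ (proj₂ (proj₂ (U.∃uniformizer l)))
      ; u∉P = proj₁ (proj₂ (proj₂ (proj₂ (U.∃uniformizer l))))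
      ; t∉P = proj₁ (proj₂ (cofactor l))
      ; uP⊆qR = λ x∈P → let y , eq = proj₂ (proj₂ (proj₂ (proj₂ (U.∃uniformizer l)))) x∈P in y , ↑ eq
      ; tPᵉ≈0 = λ {x} x∈ → PD.∈⇒≡0 K-isIdeal
          (ID.IsIdeal.resp K-isIdeal (D.*-comm x t) (cofactor-annihilates l x∈))
      }
      where
      q = proj₁ (U.∃uniformizer l)
      u = proj₁ (proj₂ (U.∃uniformizer l))
      t = proj₁ (cofactor l)

    -- An element of C outside `P l` is a unit modulo `Pᵉ l`, which gives π l ∈ `Pᵉ l` congruent to
    -- 1 modulo C. The product of the π l lies in K, hence in C, and it is congruent to 1.
    1∈-local : ∀ {C} → IR.IsIdeal C → (∀ l → ∃[ s ] (s ∈ C × s ∉ P l)) → D.1# ∈ C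
    1∈-local {C} isC meets = PD.∈-resp-≡ isC′ (D/C.sym {product π} {D.1#}
      (D/C.trans {product π} (sum-cong-≋ {n} {π} {λ _ → D.1#} π≡1) (sum-replicate-zero n)))
      (K⊆ isC (∏Pᵉ⊆K (PD.∏ᴵ-intro Pᵉ (λ l → proj₁ (proj₂ (proj₂ (unit l)))))))
      where
      isC′ : ID.IsIdeal C
      isC′ = preimage-isIdeal isC
      module D/C = CommutativeRing (quotientRing D C isC′)
      open import Algebra.Properties.Monoid.Sum D/C.*-monoid using (sum-cong-≋; sum-replicate-zero)
      s : Vector D.Carrier n
      s l = proj₁ (meets l)
      unit : ∀ l → PD.IsUnitModulo (Pᵉ l) (s l)
      unit l = PD.unit-^ (U.∉⇒unit l (proj₂ (proj₂ (meets l)))) (e l)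
      π : Vector D.Carrier n
      π l = proj₁ (proj₂ (unit l))
      π≡1 : ∀ l → π l D.- D.1# ∈ C
      π≡1 l = D/C.trans {π l} {s l D.* proj₁ (unit l) D.+ π l} {D.1#}
        (D/C.trans {π l} {D.0# D.+ π l} (D/C.sym {D.0# D.+ π l} {π l} (D/C.+-identityˡ (π l)))
          (D/C.+-congʳ {π l} {D.0#} {s l D.* proj₁ (unit l)} (D/C.sym {s l D.* proj₁ (unit l)} {D.0#}
            (PD.∈⇒≡0 isC′ (PD.*-closedʳ isC′ _ (proj₁ (proj₂ (meets l))))))))
        (PD.≈⇒≡ isC′ (proj₂ (proj₂ (proj₂ (unit l)))))

    K⊆J : K ⊆ J
    K⊆J = proj₂

    isJ : IR.IsIdeal J
    isJ = image-isIdeal J-isIdeal K⊆J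

  private
    module SL = Semilocal em R isChainPrime 1∈-local separate
    module F i = SL.Factorials (λ l → aₗ-isOrdering l i)
    module M = SL.Multivariate aₗ-isOrdering a-crt isJ
    module EvalR = Evaluation R
  open FiniteSums R
  open FallingFactorials R
  open Ideals R using (differences)
  open Polynomials R r

  eval-falling : ∀ k x → eval (falling k) x R.≈ multi a k x
  eval-falling k x = R.trans {eval (falling k) x} (EvalR.eval-product x (λ i → falling₁ i (lookup k i)))
    (product-cong {r} {λ i → eval (falling₁ i (lookup k i)) x} {λ i → differences (a i) (lookup k i) (x i)}
      (λ i → eval-falling₁ i (lookup k i)))
    where
    open import Algebra.Properties.Monoid.Sum R.*-monoid using () renaming (sum-cong-≋ to product-cong)
    eval-falling₁ : ∀ i m → eval (falling₁ i m) x R.≈ differences (a i) m (x i)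
    eval-falling₁ i zero    = EvalR.eval-constant x R.1#
    eval-falling₁ i (suc m) = begin
      eval (falling₁ i (suc m)) x              ≈⟨ EvalR.eval-* x (falling₁ i m) (var i +ᴾ constant (R.- a i m)) ⟩
      eval (falling₁ i m) x R.* eval (var i +ᴾ constant (R.- a i m)) x
        ≈⟨ R.*-cong {eval (falling₁ i m) x} {differences (a i) m (x i)} (eval-falling₁ i m)
             (R.trans {eval (var i +ᴾ constant (R.- a i m)) x} (EvalR.eval-+ x (var i) (constant (R.- a i m)))
               (R.+-cong {eval (var i) x} {x i} {eval (constant (R.- a i m)) x} {R.- a i m}
                 (EvalR.eval-var x i) (EvalR.eval-constant x (R.- a i m)))) ⟩
      differences (a i) m (x i) R.* (x i R.- a i m) ∎
      where open SetoidReasoning R.setoid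

  eval-polynomial : ∀ b x {N} → Family.bound b ℕ.≤ N →
                    eval (polynomial b) x R.≈ ∑box r N (λ k → Family.coeff b k R.* multi a k x)
  eval-polynomial b x {N} bound≤N = begin
    eval (polynomial b) x                                               ≈⟨ EvalR.eval-concatMap x (λ k → constant (coeff k) *ᴾ falling k) (box r bound) ⟩
    ∑ˡ (λ k → eval (constant (coeff k) *ᴾ falling k) x) (box r bound)   ≈⟨ ∑ˡ-box r bound (λ k → eval (constant (coeff k) *ᴾ falling k) x) ⟩
    ∑box r bound (λ k → eval (constant (coeff k) *ᴾ falling k) x)       ≈⟨ ∑box-cong r bound (λ k _ → term k) ⟩
    ∑box r bound (λ k → coeff k R.* multi a k x)                        ≈⟨ ∑box-extend r (λ k → coeff k R.* multi a k x) bound≤N (λ k k≮ →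
                                                                             R.trans {coeff k R.* multi a k x} {R.0# R.* multi a k x} {R.0#}
                                                                               (R.*-congʳ {multi a k x} {coeff k} {R.0#} (finite k k≮)) (R.zeroˡ (multi a k x))) ⟩
    ∑box r N (λ k → coeff k R.* multi a k x)                            ∎
    where
    open Family b
    open SetoidReasoning R.setoid
    term : ∀ k → eval (constant (coeff k) *ᴾ falling k) x R.≈ coeff k R.* multi a k x
    term k = R.trans {eval (constant (coeff k) *ᴾ falling k) x} (EvalR.eval-* x (constant (coeff k)) (falling k))
      (R.*-cong {eval (constant (coeff k)) x} {coeff k} {eval (falling k) x} {multi a k x}
        (EvalR.eval-constant x (coeff k)) (eval-falling k x))

  -- D and R have the same operations and differ only in their equality, so a polynomial over D can
  -- be read over R without changing its values.
  eval-D : ∀ F x → Polynomials.eval D r F x ≡ eval F x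
  eval-D []            x = ≡.refl
  eval-D ((c , m) ∷ F) x = ≡.cong₂ (λ p s → c D.* p D.+ s)
    (product-cong-≗ {r} (λ i → ^-D (x i) (lookup m i))) (eval-D F x)
    where
    open import Algebra.Properties.Monoid.Sum D.*-monoid using () renaming (sum-cong-≗ to product-cong-≗)
    ^-D : ∀ x m → x ^ m ≡ RawSemiringDefs._^_ (Semiring.rawSemiring R.semiring) x m
    ^-D x zero    = ≡.refl
    ^-D x (suc m) = ≡.cong (x D.*_) (^-D x m)

  private
    least : (Q : ℕ → Set (c ⊔ ℓ)) → ∃[ m ] Q m → ∃[ m ] (Q m × (∀ j → Q j → m ℕ.≤ j))
    least Q (m , Qm) = <-rec (λ m → Q m → ∃[ m ] (Q m × (∀ j → Q j → m ℕ.≤ j))) step m Qm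
      where
      step : ∀ m → (∀ {j} → j ℕ.< m → Q j → ∃[ m ] (Q m × (∀ j → Q j → m ℕ.≤ j))) →
             Q m → ∃[ m ] (Q m × (∀ j → Q j → m ℕ.≤ j))
      step m rec Qm with em {∃[ j ] (j ℕ.< m × Q j)}
      ... | yes (j , j<m , Qj) = rec j<m Qj
      ... | no none            = m , Qm , λ j Qj → ℕ.≮⇒≥ λ j<m → none (j , j<m , Qj)

    -- Since K ⊆ `I i`, the congruence passes to the representatives in `𝒟 i`, which are unique.
    -- This is what lets the pigeonhole principle act on the terms of an ordering.
    X-cancel : ∀ i {x y} → x ∈ X i → y ∈ X i → x D.- y ∈ I i → x R.≈ y
    X-cancel i {x} {y} (d , d∈ , x≈d) (d′ , d′∈ , y≈d′) x-y∈ =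
      R.trans {x} {d} {y} x≈d (R.trans {d} {d′} {y} (↑ d≈d′) (R.sym {y} {d′} y≈d′))
      where
      module D/I′ = CommutativeRing (D/I i)
      d≈d′ : d D.≈ d′
      d≈d′ = IsResidueSystem.unique (isResidueSystem i) d d′ d∈ d′∈
        (D/I′.trans {d} {x} {d′} (D/I′.sym {x} {d} (proj₁ x≈d i))
          (D/I′.trans {x} {y} {d′} x-y∈ (proj₁ y≈d′ i)))

    -- Among the first N + 1 terms of an ordering of X i two coincide.
    finite⇒v⊆J : ∀ i N → Inverse (≡.setoid (Fin N)) (CommutativeRing.setoid (D/I i)) → v i N ⊆ J
    finite⇒v⊆J i N inverse = proj₂ (F.v⊆⇔δ∈ i (a-crt i) N isJ)
      (IR.IsIdeal.resp isJ {R.0#} {F.δ i (a-crt i) N} (R.sym {F.δ i (a-crt i) N} {R.0#} δ≈0) (IR.IsIdeal.0∈ isJ))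
      where
      open Inverse inverse using (to; from; strictlyInverseˡ)
      module D/I′ = CommutativeRing (D/I i)
      from-injective : ∀ x y → from x ≡ from y → x D.- y ∈ I i
      from-injective x y eq = D/I′.trans {x} {to (from x)} {y} (D/I′.sym {to (from x)} {x} (strictlyInverseˡ x))
        (≡.subst (λ z → to z D.- y ∈ I i) (≡.sym eq) (strictlyInverseˡ y))
      repetition : ∀ l → ∃[ s ] ∃[ t ] (s ℕ.< t × t ℕ.≤ N × aₗ l i t R.≈ aₗ l i s)
      repetition l with s , t , s<t , eq ← Fin.pigeonhole (ℕ.n<1+n N) (λ j → from (aₗ l i (toℕ j))) =
        toℕ s , toℕ t , s<t , ℕ.s≤s⁻¹ (Fin.toℕ<n t) ,
        X-cancel i (b∈X (toℕ t)) (b∈X (toℕ s)) (from-injective _ _ (≡.sym eq))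
        where open IR.IsOrdering (aₗ-isOrdering l i) using (b∈X)
      δ≈0 : F.δ i (a-crt i) N R.≈ R.0#
      δ≈0 = F.repetition⇒δ≈0 i (a-crt i) N repetition

    -- `Isμ` admits only positive indices; a finite D / I i has positive cardinality because it
    -- contains 0.
    inhabited : ∀ {N} → Fin N → 1 ℕ.≤ N
    inhabited zero    = ℕ.s≤s ℕ.z≤n
    inhabited (suc _) = ℕ.s≤s ℕ.z≤n

  differences∈J : ∀ i {k m x} → x ∈ X i → v i k ⊆ J → k ℕ.≤ m → differences (a i) m x ∈ J
  differences∈J i {k} {m} {x} x∈X v⊆J k≤m =
    let y , eq  = F.differences-∣-δ i (a-crt i) k x∈X
        z , eq′ = differences-∣ (a i) {k} {m} x k≤m
    in IR.IsIdeal.resp isJ {differences (a i) k x R.* z} {differences (a i) m x} (R.sym {differences (a i) m x} eq′)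
         (PR.*-closedʳ isJ {differences (a i) k x} z
           (IR.IsIdeal.resp isJ {F.δ i (a-crt i) k R.* y} {differences (a i) k x} (R.sym {differences (a i) k x} eq)
             (PR.*-closedʳ isJ {F.δ i (a-crt i) k} y (proj₁ (F.v⊆⇔δ∈ i (a-crt i) k isJ) v⊆J))))
    where module PR = IdealProperties R

  -- If some v k with k ≥ 1 lies in J, the least such k is μ, so k ≤ m and the product of the first
  -- k differences, which divides the given one, is in J. If there is none, D / I i is infinite by
  -- `finite⇒v⊆J`; then μ is infinite and m < μ, a contradiction.
  beyond-μ : ∀ i m {x} → x ∈ X i → ¬ (∃[ μ ] (Isμ i μ × [ m ] <∞ μ)) → differences (a i) m x ∈ J
  beyond-μ i m {x} x∈X m≮μ = cases em
    where
    Bounds : ℕ → Set (c ⊔ ℓ)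
    Bounds k = 1 ℕ.≤ k × v i k ⊆ J

    cases : Dec (∃[ k ] Bounds k) → differences (a i) m x ∈ J
    cases (yes bounded) =
      let k , (1≤k , v⊆J) , minimal = least Bounds bounded in
      differences∈J i {k} {m} x∈X v⊆J (ℕ.≮⇒≥ λ m<k → m≮μ
        ([ k ] , inj₁ (k , ≡.refl , 1≤k , v⊆J , λ j 1≤j vj → minimal j (1≤j , λ {x} → vj {x})) , [ m<k ]))
    cases (no none) = ⊥-elim (m≮μ
      (⊤⁺ , inj₂ ((λ k 1≤k v⊆J → none (k , 1≤k , λ {x} → v⊆J {x})) , infinite) , [ m ]<⊤⁺))
      where
      infinite : HasCardinality (CommutativeRing.setoid (D/I i)) ⊤⁺
      infinite N inverse =
        none (N , inhabited (Inverse.from inverse D.0#) , λ {x} → finite⇒v⊆J i N inverse {x})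

  multi-∈J : ∀ k {x} → ¬ k ∈ 𝐒 → (∀ i → x i ∈ X i) → multi a k x ∈ J
  multi-∈J k k∉𝐒 x∈X =
    let i , kᵢ≮μ = Fin.¬∀⟶∃¬ r (λ i → ∃[ μ ] (Isμ i μ × [ lookup k i ] <∞ μ)) (λ i → em) k∉𝐒 in
    IdealProperties.product-closed R isJ i (beyond-μ i (lookup k i) (x∈X i) kᵢ≮μ)

  module _ (b b′ : Family) where
    private
      module b = Family b
      module b′ = Family b′
      module PR = IdealProperties R
      module J = IR.IsIdeal isJ

      γ : Vec ℕ r → Carrier
      γ k = b.coeff k R.- b′.coeff k

      N : ℕ
      N = b.bound ℕ.⊔ b′.bound

      γ∈J : ∀ k → b.coeff k R.≈ R.0# → b′.coeff k R.≈ R.0# → γ k ∈ J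
      γ∈J k p q = J.resp {R.0# R.- R.0#} {γ k}
        (R.sym {γ k} (R.+-cong {b.coeff k} {R.0#} {R.- b′.coeff k} p (R.-‿cong {b′.coeff k} q)))
        (J.resp {R.0#} (R.sym {R.0# R.- R.0#} {R.0#} (R.-‿inverseʳ R.0#)) J.0∈)

      difference : ∀ x → eval (polynomial b) x R.- eval (polynomial b′) x R.≈
                         ∑box r N (λ k → γ k R.* multi a k x)
      difference x = R.trans {eval (polynomial b) x R.- eval (polynomial b′) x} {∑ b.coeff R.- ∑ b′.coeff}
        (R.+-cong {eval (polynomial b) x} {∑ b.coeff} (eval-polynomial b x (ℕ.m≤m⊔n b.bound b′.bound))
          (R.-‿cong {eval (polynomial b′) x} {∑ b′.coeff} (eval-polynomial b′ x (ℕ.m≤n⊔m b.bound b′.bound))))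
        (∑box-difference r N b.coeff b′.coeff (λ k → multi a k x))
        where
        ∑ : (Vec ℕ r → Carrier) → Carrier
        ∑ g = ∑box r N (λ k → g k R.* multi a k x)

    same-values⇒Ann : (∀ {x} → (∀ i → x i ∈ 𝒟 i) → eval (polynomial b) x R.- eval (polynomial b′) x ∈ J) →
                      ∀ k → γ k ∈ Ann (vAt k)
    same-values⇒Ann same k = M.⇒ann k {γ k} (γΔ∈J (Fin.all? λ i → lookup k i ℕ.<? N))
      where
      module V = Vanishing R isJ
      module R/J = CommutativeRing (quotientRing R J isJ)

      values∈J : ∀ {x} → (∀ i → x i ∈ X i) → ∑box r N (λ k → γ k R.* multi a k x) ∈ J
      -- `same` concerns residues in 𝒟; each x i is congruent modulo K to such a residue y i, so the
      -- values differ by an element of J.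
      values∈J {x} x∈X = IdealSums.∑box-∈-resp R isJ r N
        {λ k → γ k R.* multi a k x} {λ k → γ k R.* multi a k y}
        (λ k → R/J.*-congˡ {γ k} {multi a k x} {multi a k y}
          (V.multi-cong {r} {a} {a} {x} {y} (λ i j → R/J.refl {a i j}) (λ i → K⊆J (proj₂ (proj₂ (x∈X i)))) k))
        (J.resp {eval (polynomial b) y R.- eval (polynomial b′) y} {∑box r N (λ k → γ k R.* multi a k y)}
          (difference y) (same (λ i → proj₁ (proj₂ (x∈X i)))))
        where
        y : Vector Carrier r
        y i = proj₁ (x∈X i)

      γΔ∈J : Dec (∀ i → lookup k i ℕ.< N) → γ k R.* M.Δ k ∈ J
      γΔ∈J (yes k<N) = M.coefficients∈ N γ values∈J k k<N
      -- Outside the common box both coefficients are 0 by finiteness of the supports.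
      γΔ∈J (no k≮N)  = PR.*-closedʳ isJ {γ k} (M.Δ k) (γ∈J k
        (b.finite k λ k< → k≮N λ i → ℕ.<-≤-trans (k< i) (ℕ.m≤m⊔n b.bound b′.bound))
        (b′.finite k λ k< → k≮N λ i → ℕ.<-≤-trans (k< i) (ℕ.m≤n⊔m b.bound b′.bound)))

    Ann⇒same-values : (∀ k → k ∈ 𝐒 → γ k ∈ Ann (vAt k)) →
                      ∀ {x} → (∀ i → x i ∈ X i) → eval (polynomial b) x R.- eval (polynomial b′) x ∈ J
    Ann⇒same-values ann {x} x∈X = J.resp {∑box r N (λ k → γ k R.* multi a k x)}
      (R.sym {eval (polynomial b) x R.- eval (polynomial b′) x} (difference x))
      (M.values∈ N γ (λ k _ → γΔ∈J k em) x∈X)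
      where
      γΔ∈J : ∀ k → Dec (k ∈ 𝐒) → γ k R.* M.Δ k ∈ J
      γΔ∈J k (yes k∈𝐒) = M.ann⇒ k {γ k} (ann k k∈𝐒)
      γΔ∈J k (no k∉𝐒)  = PR.*-closedʳ isJ {γ k} (M.Δ k) (γ∈J k (b.zeroOutside k k∉𝐒) (b′.zeroOutside k k∉𝐒))

  ∈𝒟⇒∈X : ∀ {x : Vector Carrier r} → (∀ i → x i ∈ 𝒟 i) → ∀ i → x i ∈ X i
  ∈𝒟⇒∈X {x} x∈𝒟 i = x i , x∈𝒟 i , R.refl {x i}

  private


    restrict : ∀ {A : Set (c ⊔ ℓ)} → Dec A → Carrier → Carrier
    restrict (yes _) z = z
    restrict (no _)  z = R.0#

    restrict-∉ : ∀ {A} (A? : Dec A) z → ¬ A → restrict A? z R.≈ R.0#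
    restrict-∉ (yes p) z ¬p = contradiction p ¬p
    restrict-∉ (no _)  z ¬p = R.refl {R.0#}

    restrict-0 : ∀ {A} (A? : Dec A) {z} → z R.≈ R.0# → restrict A? z R.≈ R.0#
    restrict-0 (yes _) z≈0 = z≈0
    restrict-0 (no _)  z≈0 = R.refl {R.0#}

    restrict-≡ : ∀ {A} (A? : Dec A) z m → (¬ A → m ∈ J) → restrict A? z R.* m R.- z R.* m ∈ J
    restrict-≡ (yes _) z m _    = IdealProperties.≈⇒≡ R isJ {z R.* m} {z R.* m} (R.refl {z R.* m})
    restrict-≡ (no ¬p) z m m∈J = IdealProperties.∈⇒≡ R isJ {R.0# R.* m} {z R.* m}
      (IR.IsIdeal.*-closed isJ R.0# (m∈J ¬p)) (IR.IsIdeal.*-closed isJ z (m∈J ¬p))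

  restrictedFamily : Polynomial → Family
  restrictedFamily F = record
    { coeff       = λ k → restrict (em {k ∈ 𝐒}) (EvalR.coefficient a F k)
    ; bound       = EvalR.degreeBound a F
    ; zeroOutside = λ k → restrict-∉ (em {k ∈ 𝐒}) (EvalR.coefficient a F k)
    ; finite      = λ k k≮ → restrict-0 (em {k ∈ 𝐒}) (EvalR.coefficient-0 a F k ℕ.≤-refl k≮)
    }

  eval-restrictedFamily : ∀ F {x} → (∀ i → x i ∈ X i) →
                          eval (polynomial (restrictedFamily F)) x R.- eval F x ∈ J
  eval-restrictedFamily F {x} x∈X = R/J.trans {eval (polynomial (restrictedFamily F)) x} {∑ (Family.coeff (restrictedFamily F))} {eval F x}
    (K⊆J (eval-polynomial (restrictedFamily F) x ℕ.≤-refl))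
    (R/J.trans {∑ (Family.coeff (restrictedFamily F))} {∑ (EvalR.coefficient a F)} {eval F x}
      dropped (K⊆J (EvalR.expansion a F x ℕ.≤-refl)))
    where
    module R/J = CommutativeRing (quotientRing R J isJ)
    N = EvalR.degreeBound a F
    ∑ : (Vec ℕ r → Carrier) → Carrier
    ∑ g = ∑box r N (λ k → g k R.* multi a k x)
    dropped : ∑ (Family.coeff (restrictedFamily F)) R.- ∑ (EvalR.coefficient a F) ∈ J
    dropped = IdealSums.∑box-≡ R isJ r N λ k →
      restrict-≡ (em {k ∈ 𝐒}) (EvalR.coefficient a F k) (multi a k x) λ k∉𝐒 → multi-∈J k k∉𝐒 x∈X

mainTheorem2 : {c ℓ : Level} → ExcludedMiddle (lsuc (c ⊔ ℓ)) →
    (S : Setting c ℓ) (Q : FixedSequences S) →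
    let open Setting S
        open Notation S Q
        open CommutativeRing R using (_-_)
        open Family using (coeff)
    in
    (f : Function) → IsPolynomialFunction f →
    ∃[ b ] (Represents (polynomial b) f ×
      (∀ b′ → Represents (polynomial b′) f ⇔
        (∀ k → k ∈ 𝐒 → coeff b k - coeff b′ k ∈ Ann (vAt k))))
mainTheorem2 {c} {ℓ} em S Q f (F , F-represents) = b , represents , λ b′ → mk⇔
  (λ represents′ k _ → same-values⇒Ann b b′ (λ {x} x∈𝒟 →
     D/J.trans {eval (polynomial b) x} {Func.to f (x , x∈𝒟)} {eval (polynomial b′) x} (represents (x , x∈𝒟))
       (D/J.sym {eval (polynomial b′) x} {Func.to f (x , x∈𝒟)} (represents′ (x , x∈𝒟)))) k)
  (λ ann (x , x∈𝒟) → D/J.trans {eval (polynomial b′) x} {eval (polynomial b) x} {Func.to f (x , x∈𝒟)}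
     (D/J.sym {eval (polynomial b) x} {eval (polynomial b′) x} (Ann⇒same-values b b′ ann (∈𝒟⇒∈X x∈𝒟)))
     (represents (x , x∈𝒟)))
  where
  open Setting S
  open Notation S Q
  open Polynomials R r using (eval)
  module D/J = CommutativeRing D/J
  open MainTheorem (λ {A} → map′ lower (lift {ℓ = lsuc (c ⊔ ℓ)}) (em {Lift (lsuc (c ⊔ ℓ)) A})) S Q

  b : Family
  b = restrictedFamily F

  represents : Represents (polynomial b) f
  represents (x , x∈𝒟) = D/J.trans {eval (polynomial b) x} {eval F x} {Func.to f (x , x∈𝒟)}
    (eval-restrictedFamily F (∈𝒟⇒∈X x∈𝒟))
    (≡.subst (λ z → z D/J.- Func.to f (x , x∈𝒟) ∈ J) (eval-D F x) (F-represents (x , x∈𝒟)))
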